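{- Each of the following statistics on D-permutations exhibits the cyclic sieving phenomenon on $\mathfrak{D}_{2n}$ with respect to involutions having $2^nF_{2n-1}$ fixed points: nrcpeak, nrcval, $\mathrm{nrcpeak}+\mathrm{nrcval}+\mathrm{nrcdrise}+\mathrm{nrcdfall}$ (neither-record-antirecords that are not fixed points), lcrosscpeak, lnestcpeak, ucrosscval, unestcval, lcross, lnest, ucross, unest, crossings $\mathrm{ucross}+\mathrm{lcross}$, nestings $\mathrm{unest}+\mathrm{lnest}$.
   Context: A D-permutation of $[2n]$ is a permutation $\sigma$ of $[2n]$ with $\sigma(2k-1)\ge2k-1$ and $\sigma(2k)\le2k$ for all $k$; $\mathfrak{D}_{2n}$ is their set. $F_{2n-1}$ denotes $a_n$ with $a_0=a_1=1$, $a_n=3a_{n-1}-a_{n-2}$. For $i\in[2n]$: cycle peak if $\sigma^{ -1}(i)<i>\sigma(i)$, cycle valley if $\sigma^{ -1}(i)>i<\sigma(i)$, cycle double rise if $\sigma^{ -1}(i)<i<\sigma(i)$, cycle double fall if $\sigma^{ -1}(i)>i>\sigma(i)$. $i$ is a record if $\sigma(j)<\sigma(i)$ for all $j<i$, an antirecord if $\sigma(j)>\sigma(i)$ for all $j>i$; nrcpeak, nrcval, nrcdrise, nrcdfall = numbers of cycle peaks, valleys, double rises, double falls that are neither records nor antirecords. $\mathrm{ucross}(i,\sigma)=\#\{j:j<i<\sigma(j)<\sigma(i)\}$, $\mathrm{unest}(i,\sigma)=\#\{j:j<i<\sigma(i)<\sigma(j)\}$, $\mathrm{lcross}(i,\sigma)=\#\{j:j>i>\sigma(j)>\sigma(i)\}$,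 $\mathrm{lnest}(i,\sigma)=\#\{j:j>i>\sigma(i)>\sigma(j)\}$; ucross, unest, lcross, lnest are sums over all $i$; ucrosscval, unestcval are sums over cycle valleys; lcrosscpeak, lnestcpeak are sums over cycle peaks. Cyclic sieving for involutions: for an involution $\phi$ on a finite set $X$ and polynomial $f$, $(X,\{\mathrm{id},\phi\},f)$ exhibits the CSP iff $f(1)=|X|$ and $f(-1)$ equals the number of fixed points of $\phi$; a statistic exhibits the CSP on $\mathfrak{D}_{2n}$ with respect to involutions having $a_n$ fixed points if for every $n\ge0$ and every involution $\phi$ of $\mathfrak{D}_{2n}$ with exactly $a_n$ fixed points, $(\mathfrak{D}_{2n},\{\mathrm{id},\phi\},\sum_{\sigma\in\mathfrak{D}_{2n}}q^{\mathrm{stat}(\sigma)})$ exhibits the CSP. -}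

module Defs where

open import Data.Bool using (Bool; true; false; T; _∧_; _∨_; not; if_then_else_)
open import Data.Bool.Properties using (T-irrelevant)
open import Data.Nat using (ℕ; zero; suc; _+_; _*_; _∸_; _^_; _<ᵇ_; _≡ᵇ_)
open import Data.Fin using (Fin; toℕ)
import Data.Fin.Properties as FinP
open import Data.List using (List; []; _∷_; map; concatMap; allFin; length; foldr)
open import Data.Vec using (Vec; lookup) renaming ([] to []ᵥ; _∷_ to _∷ᵥ_)
import Data.Vec.Properties as VecP
open import Data.Product using (Σ; _×_; _,_; proj₁)
import Data.Product.Properties as ProdP
open import Data.Integer using (ℤ) renaming (_+_ to _+ℤ_; _^_ to _^ℤ_; +_ to +ℤ_)
open import Relation.Nullary using (Dec; yes; no; does)
open import Relation.Nullary.Decidable using (T?)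
open import Relation.Binary.PropositionalEquality using (_≡_)
open import Relation.Binary.Definitions using (DecidableEquality)

allB : {A : Set} → (A → Bool) → List A → Bool
allB p xs = foldr (λ x acc → p x ∧ acc) true xs

countB : {A : Set} → (A → Bool) → List A → ℕ
countB p xs = foldr (λ x acc → (if p x then 1 else 0) + acc) 0 xs

sumℤ : {A : Set} → (A → ℤ) → List A → ℤ
sumℤ f xs = foldr (λ x acc → f x +ℤ acc) (+ℤ 0) xs

-- A finite set X is given by a duplicate-free complete enumeration 'enum'
-- (|X| = length enum) together with decidable equality on X.
-- Number of fixed points of a map φ : X → X.
fixCount : {A : Set} → List A → DecidableEquality A → (A → A) → ℕ
fixCount enum _≟_ φ = countB (λ x → does (φ x ≟ x)) enum

IsInvolution : {A : Set} → (A → A) → Set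
IsInvolution φ = ∀ x → φ (φ x) ≡ x

-- (X, {id, φ}, f) exhibits the CSP iff f(1) = |X| and f(-1) = #fixed points of φ.
-- f is given by its evaluation map ℤ → ℤ.
CSP₂ : {A : Set} → (enum : List A) → DecidableEquality A → (φ : A → A) → (f : ℤ → ℤ) → Set
CSP₂ enum _≟_ φ f = (f (+ℤ 1) ≡ +ℤ length enum) × (f (Data.Integer.-_ (+ℤ 1)) ≡ +ℤ fixCount enum _≟_ φ)

-- Permutations as vectors of images (0-indexed: position i ↦ σ(i+1) - 1)

_<F_ : {m : ℕ} → Fin m → Fin m → Bool
i <F j = toℕ i <ᵇ toℕ j

_≡F_ : {m : ℕ} → Fin m → Fin m → Bool
i ≡F j = toℕ i ≡ᵇ toℕ j

app : {m : ℕ} → Vec (Fin m) m → Fin m → Fin m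
app v i = lookup v i

isPerm : {m : ℕ} → Vec (Fin m) m → Bool
isPerm {m} v = allB (λ i → allB (λ j → (i ≡F j) ∨ not (app v i ≡F app v j)) (allFin m)) (allFin m)

-- even (0-indexed) positions i = 2k-2 correspond to 2k-1: σ(2k-1) ≥ 2k-1;
-- odd (0-indexed) positions i = 2k-1 correspond to 2k: σ(2k) ≤ 2k
isEvenℕ : ℕ → Bool
isEvenℕ zero = true
isEvenℕ (suc n) = not (isEvenℕ n)

isDCond : {m : ℕ} → Vec (Fin m) m → Bool
isDCond {m} v = allB (λ i → if isEvenℕ (toℕ i) then not (app v i <F i) else not (i <F app v i)) (allFin m)

isDPerm : {m : ℕ} → Vec (Fin m) m → Bool
isDPerm v = isPerm v ∧ isDCond v

𝔇 : ℕ → Set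
𝔇 n = Σ (Vec (Fin (2 * n)) (2 * n)) (λ v → T (isDPerm v))

dec𝔇 : (n : ℕ) → DecidableEquality (𝔇 n)
dec𝔇 n = ProdP.≡-dec (VecP.≡-dec FinP._≟_) (λ p q → yes (T-irrelevant p q))

allVecs : (m k : ℕ) → List (Vec (Fin m) k)
allVecs m zero = []ᵥ ∷ []
allVecs m (suc k) = concatMap (λ x → map (x ∷ᵥ_) (allVecs m k)) (allFin m)

keepD : (n : ℕ) → List (Vec (Fin (2 * n)) (2 * n)) → List (𝔇 n)
keepD n [] = []
keepD n (v ∷ vs) with T? (isDPerm v)
... | yes p = (v , p) ∷ keepD n vs
... | no _ = keepD n vs

enum𝔇 : (n : ℕ) → List (𝔇 n)
enum𝔇 n = keepD n (allVecs (2 * n) (2 * n))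

module _ {m : ℕ} (v : Vec (Fin m) m) where

  σ : Fin m → Fin m
  σ = app v

  findPre : Fin m → List (Fin m) → Fin m
  findPre i [] = i
  findPre i (j ∷ js) = if σ j ≡F i then j else findPre i js

  σ⁻¹ : Fin m → Fin m
  σ⁻¹ i = findPre i (allFin m)

  isCPeak isCVal isCDRise isCDFall isRecord isAntirecord : Fin m → Bool
  isCPeak i = (σ⁻¹ i <F i) ∧ (σ i <F i)
  isCVal i = (i <F σ⁻¹ i) ∧ (i <F σ i)
  isCDRise i = (σ⁻¹ i <F i) ∧ (i <F σ i)
  isCDFall i = (i <F σ⁻¹ i) ∧ (σ i <F i)
  isRecord i = allB (λ j → not (j <F i) ∨ (σ j <F σ i)) (allFin m)
  isAntirecord i = allB (λ j → not (i <F j) ∨ (σ i <F σ j)) (allFin m)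

  nr : (Fin m → Bool) → ℕ
  nr P = countB (λ i → P i ∧ not (isRecord i) ∧ not (isAntirecord i)) (allFin m)

  nrcpeak nrcval nrcdrise nrcdfall : ℕ
  nrcpeak = nr isCPeak
  nrcval = nr isCVal
  nrcdrise = nr isCDRise
  nrcdfall = nr isCDFall

  ucrossAt unestAt lcrossAt lnestAt : Fin m → ℕ
  ucrossAt i = countB (λ j → (j <F i) ∧ (i <F σ j) ∧ (σ j <F σ i)) (allFin m)
  unestAt i = countB (λ j → (j <F i) ∧ (i <F σ i) ∧ (σ i <F σ j)) (allFin m)
  lcrossAt i = countB (λ j → (i <F j) ∧ (σ j <F i) ∧ (σ i <F σ j)) (allFin m)
  lnestAt i = countB (λ j → (i <F j) ∧ (σ i <F i) ∧ (σ j <F σ i)) (allFin m)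

  sumOver : (Fin m → Bool) → (Fin m → ℕ) → ℕ
  sumOver P f = foldr (λ i acc → (if P i then f i else 0) + acc) 0 (allFin m)

  ucross unest lcross lnest ucrosscval unestcval lcrosscpeak lnestcpeak : ℕ
  ucross = sumOver (λ _ → true) ucrossAt
  unest = sumOver (λ _ → true) unestAt
  lcross = sumOver (λ _ → true) lcrossAt
  lnest = sumOver (λ _ → true) lnestAt
  ucrosscval = sumOver isCVal ucrossAt
  unestcval = sumOver isCVal unestAt
  lcrosscpeak = sumOver isCPeak lcrossAt
  lnestcpeak = sumOver isCPeak lnestAt

data StatName : Set where
  s-nrcpeak s-nrcval s-nrcAll s-lcrosscpeak s-lnestcpeak s-ucrosscval s-unestcval : StatName
  s-lcross s-lnest s-ucross s-unest s-cross s-nest : StatName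

stat : StatName → {m : ℕ} → Vec (Fin m) m → ℕ
stat s-nrcpeak v = nrcpeak v
stat s-nrcval v = nrcval v
stat s-nrcAll v = nrcpeak v + nrcval v + nrcdrise v + nrcdfall v
stat s-lcrosscpeak v = lcrosscpeak v
stat s-lnestcpeak v = lnestcpeak v
stat s-ucrosscval v = ucrosscval v
stat s-unestcval v = unestcval v
stat s-lcross v = lcross v
stat s-lnest v = lnest v
stat s-ucross v = ucross v
stat s-unest v = unest v
stat s-cross v = ucross v + lcross v
stat s-nest v = unest v + lnest v

F2n-1 : ℕ → ℕ
F2n-1 zero = 1
F2n-1 (suc zero) = 1
F2n-1 (suc (suc n)) = 3 * F2n-1 (suc n) ∸ F2n-1 n

genPoly : (n : ℕ) → ((v : Vec (Fin (2 * n)) (2 * n)) → ℕ) → ℤ → ℤ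
genPoly n st q = sumℤ (λ s → q ^ℤ st (proj₁ s)) (enum𝔇 n)

ExhibitsCSP : (c : ℕ → ℕ) → ({m : ℕ} → Vec (Fin m) m → ℕ) → Set
ExhibitsCSP c st = (n : ℕ) → (φ : 𝔇 n → 𝔇 n) → IsInvolution φ →
  fixCount (enum𝔇 n) (dec𝔇 n) φ ≡ c n →
  CSP₂ (enum𝔇 n) (dec𝔇 n) φ (genPoly n st)

{-# OPTIONS --safe #-}
module Submission where

-- Call the height of σ at h the number of positions j ≥ h with σ(j) < h, and σ
-- good if all heights are at most 1.  If σ is not good, let k be the largest h
-- of height ≥ 2.  Then exactly two positions k < k' lie at or after k with
-- values below k, k is a cycle peak, and exchanging σ(k) and σ(k') is an
-- involution which turns the one lower crossing at k into a nesting (or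
-- conversely, creating or destroying an antirecord) and changes nothing else:
-- every statistic on lower arcs changes by exactly 1.  A good σ has no crossings
-- or nestings, so all its statistics vanish and the value at −1 is the number of
-- good D-permutations.  The statistics on upper arcs only are the lower ones of
-- the conjugate by i ↦ 2n + 1 − i.
--
-- Good permutations are counted by treating 1, …, 2n in order.  With a and b the
-- numbers of partial permutations having height 0 and 1 after 2n steps, two
-- more steps give a' = 2a + 2b and b' = 2a + 4b, whence a = 2ⁿ F₂ₙ₋₁.

open import Defs
open import Algebra.Bundles using (CommutativeMonoid)
open import Data.Bool using (Bool; true; false; T; _∧_; _∨_; not; if_then_else_)
open import Data.Bool.Properties using (T-∧; T-irrelevant; ∧-comm; not-involutive)
open import Data.Empty using (⊥; ⊥-elim)
open import Data.Fin as Fin using (Fin; toℕ; fromℕ<; punchOut; opposite) renaming (_<_ to _<ᶠ_)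
open import Data.Fin.Permutation.Components using (transpose)
open import Data.Fin.Properties using (_≟_; any?; <-cmp; <-trans; <-asym; <-irrefl; toℕ-injective; toℕ<n; fromℕ<-toℕ; toℕ-fromℕ<; punchOut-injective; injective⇒≤; opposite-involutive; opposite-prop)
open import Data.Integer as ℤ using (ℤ; 0ℤ; 1ℤ; -1ℤ)
import Data.Integer.Properties as ℤ
open import Data.List as List using (List; []; _∷_; map; concatMap; cartesianProductWith; _++_; length; filter; foldr; allFin)
open import Data.List.Membership.Propositional using (_∈_)
open import Data.List.Membership.Propositional.Properties using (∈-allFin; ∈-map⁺; ∈-lookup; ∈-cartesianProductWith⁺; ∈-filter⁺)
open import Data.List.Membership.Propositional.Properties.WithK using (unique∧set⇒bag)
open import Data.List.Membership.Setoid.Properties using (index-injective)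
open import Data.List.Properties using (length-map; length-++)
open import Data.List.Relation.Binary.BagAndSetEquality using (∼bag⇒↭)
open import Data.List.Relation.Binary.Permutation.Propositional as ↭ using (_↭_)
open import Data.List.Relation.Unary.All as All using (All; []; _∷_)
import Data.List.Relation.Unary.All.Properties as All
open import Data.List.Relation.Unary.AllPairs using ([]; _∷_)
open import Data.List.Relation.Unary.Any as Any using (Any; here; there)
import Data.List.Relation.Unary.Any.Properties as Any
open import Data.List.Relation.Unary.Unique.Propositional using (Unique)
open import Data.List.Relation.Unary.Unique.Propositional.Properties using (allFin⁺; map⁺; cartesianProductWith⁺; filter⁺)
import Data.List.Relation.Unary.Unique.Setoid as Setoid
import Data.List.Relation.Unary.Unique.Setoid.Properties as Setoid
open import Data.Nat using (ℕ; zero; suc; _+_; _*_; _∸_; _^_; _≤_; _<_; _<ᵇ_; _≡ᵇ_; z≤n; s≤s; s≤s⁻¹)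
import Data.Nat.Properties as ℕ
open import Data.Nat.Tactic.RingSolver using (solve-∀)
open import Data.Product using (_×_; _,_; proj₁; proj₂; ∃; ∃₂)
open import Data.Sum using (_⊎_; inj₁; inj₂; [_,_]′)
open import Data.Vec using (Vec; []; _∷_; lookup; tabulate)
open import Data.Vec.Properties using (lookup∘tabulate; tabulate∘lookup; tabulate-cong; ∷-injective)
open import Function using (_∘_; id; mk⇔; Equivalence; Injective)
open import Level using (0ℓ)
open import Relation.Binary.Definitions using (tri<; tri≈; tri>)
open import Relation.Binary.PropositionalEquality using (_≡_; _≢_; _≗_; _→-setoid_; refl; sym; trans; cong; cong₂; subst; subst₂; setoid; ≢-sym; module ≡-Reasoning)
open import Relation.Nullary using (¬_; Dec; does; yes; no; contradiction; ¬?; _×-dec_)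
open import Relation.Nullary.Decidable using (T?)

private
  variable
    A : Set
    m : ℕ

-- Sums over finite lists

module Sum (M : CommutativeMonoid 0ℓ 0ℓ) where
  open CommutativeMonoid M renaming (refl to ≈-refl; sym to ≈-sym; trans to ≈-trans)

  ∑ : (A → Carrier) → List A → Carrier
  ∑ f = foldr (λ x acc → f x ∙ acc) ε

  ∑-cong : {f g : A → Carrier} → (∀ x → f x ≈ g x) → ∀ xs → ∑ f xs ≈ ∑ g xs
  ∑-cong f≈g []       = ≈-refl
  ∑-cong f≈g (x ∷ xs) = ∙-cong (f≈g x) (∑-cong f≈g xs)

  ∑-map : ∀ (f : A → Carrier) (ψ : A → A) xs → ∑ f (map ψ xs) ≈ ∑ (f ∘ ψ) xs
  ∑-map f ψ []       = ≈-refl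
  ∑-map f ψ (x ∷ xs) = ∙-cong ≈-refl (∑-map f ψ xs)

  ∑-↭ : ∀ (f : A → Carrier) {xs ys} → xs ↭ ys → ∑ f xs ≈ ∑ f ys
  ∑-↭ f ↭.refl         = ≈-refl
  ∑-↭ f (↭.prep x p)   = ∙-cong ≈-refl (∑-↭ f p)
  ∑-↭ f (↭.swap x y p) =
    ≈-trans (≈-sym (assoc _ _ _))
      (≈-trans (∙-cong (comm _ _) (∑-↭ f p)) (assoc _ _ _))
  ∑-↭ f (↭.trans p q)  = ≈-trans (∑-↭ f p) (∑-↭ f q)

  -- An involution sends a duplicate-free complete list to another such list, and any two of these
  -- are permutations of each other.
  ∑-involution : ∀ (f : A → Carrier) {xs} → Unique xs → (∀ x → x ∈ xs) →
                 ∀ ψ → IsInvolution ψ → ∑ f xs ≈ ∑ (f ∘ ψ) xs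
  ∑-involution f {xs} unique complete ψ inv =
    ≈-trans (∑-↭ f xs↭ψxs) (∑-map f ψ xs)
    where
    xs↭ψxs : xs ↭ map ψ xs
    xs↭ψxs = ∼bag⇒↭ (unique∧set⇒bag unique
      (map⁺ (λ {x} {y} e → trans (sym (inv x)) (trans (cong ψ e) (inv y))) unique)
      λ {x} → mk⇔ (λ _ → subst (_∈ map ψ xs) (inv x) (∈-map⁺ ψ (complete (ψ x))))
                  (λ _ → complete x))

open Sum ℕ.+-0-commutativeMonoid

-- Only the terms at `k` differ; adding them crosswise avoids subtraction in ℕ.
∑-updateAt : {f g : A → ℕ} {xs : List A} {k : A} → Unique xs → k ∈ xs →
             (∀ x → x ≢ k → f x ≡ g x) → ∑ f xs + g k ≡ ∑ g xs + f k
∑-updateAt {f = f} {g} {x ∷ xs} (x∉ ∷ _) (here refl) same = begin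
  (f x + ∑ f xs) + g x  ≡⟨ cong (λ s → (f x + s) + g x) (tail-same x∉) ⟩
  (f x + ∑ g xs) + g x  ≡⟨ ℕ.+-comm _ (g x) ⟩
  g x + (f x + ∑ g xs)  ≡⟨ cong (g x +_) (ℕ.+-comm (f x) _) ⟩
  g x + (∑ g xs + f x)  ≡⟨ ℕ.+-assoc (g x) _ _ ⟨
  (g x + ∑ g xs) + f x  ∎
  where
  open ≡-Reasoning
  tail-same : ∀ {ys} → All (x ≢_) ys → ∑ f ys ≡ ∑ g ys
  tail-same []       = refl
  tail-same (p ∷ ps) = cong₂ _+_ (same _ (≢-sym p)) (tail-same ps)
∑-updateAt {f = f} {g} {x ∷ xs} {k} (x∉ ∷ u) (there k∈) same = begin
  (f x + ∑ f xs) + g k  ≡⟨ ℕ.+-assoc (f x) _ _ ⟩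
  f x + (∑ f xs + g k)  ≡⟨ cong₂ _+_ (same x (x≢k x∉ k∈)) (∑-updateAt u k∈ same) ⟩
  g x + (∑ g xs + f k)  ≡⟨ ℕ.+-assoc (g x) _ _ ⟨
  (g x + ∑ g xs) + f k  ∎
  where
  open ≡-Reasoning
  x≢k : ∀ {ys} → All (x ≢_) ys → k ∈ ys → x ≢ k
  x≢k (p ∷ _)  (here refl) = p
  x≢k (_ ∷ ps) (there q)     = x≢k ps q

∑-zero : ∀ {f : A → ℕ} → (∀ x → f x ≡ 0) → ∀ xs → ∑ f xs ≡ 0
∑-zero f≡0 []       = refl
∑-zero f≡0 (x ∷ xs) = cong₂ _+_ (f≡0 x) (∑-zero f≡0 xs)

∑-supportedAt : ∀ {f : Fin m → ℕ} k → (∀ i → i ≢ k → f i ≡ 0) → ∑ f (allFin m) ≡ f k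
∑-supportedAt {m} {f} k zero-off = begin
  ∑ f (allFin m)            ≡⟨ ℕ.+-identityʳ _ ⟨
  ∑ f (allFin m) + 0        ≡⟨ ∑-updateAt (allFin⁺ m) (∈-allFin k) zero-off ⟩
  ∑ (λ _ → 0) (allFin m) + f k  ≡⟨ cong (_+ f k) (∑-zero (λ _ → refl) (allFin m)) ⟩
  f k                       ∎
  where open ≡-Reasoning

-- No direction is fixed: an exchange may raise or lower a statistic, and for the value at -1 only
-- the change of parity matters.
Adjacent : ℕ → ℕ → Set
Adjacent a b = a ≡ suc b ⊎ b ≡ suc a

adjacent-+ : ∀ {a b c d} → a ≡ b → Adjacent c d → Adjacent (a + c) (b + d)
adjacent-+ refl (inj₁ refl) = inj₁ (ℕ.+-suc _ _)
adjacent-+ refl (inj₂ refl) = inj₂ (ℕ.+-suc _ _)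

+-adjacent : ∀ {a b c d} → Adjacent a b → c ≡ d → Adjacent (a + c) (b + d)
+-adjacent (inj₁ refl) refl = inj₁ refl
+-adjacent (inj₂ refl) refl = inj₂ refl

∑-adjacent : ∀ {f g : Fin m → ℕ} k → (∀ i → i ≢ k → f i ≡ g i) →
             Adjacent (f k) (g k) → Adjacent (∑ f (allFin m)) (∑ g (allFin m))
∑-adjacent {m} {f} {g} k same adj = cancel adj (∑-updateAt (allFin⁺ m) (∈-allFin k) same)
  where
  cancel : ∀ {s t a b} → Adjacent a b → s + b ≡ t + a → Adjacent s t
  cancel {s} {t} {b = b} (inj₁ refl) e = inj₁ (ℕ.+-cancelʳ-≡ b s (suc t) (trans e (ℕ.+-suc t b)))
  cancel {s} {t} {a = a} (inj₂ refl) e = inj₂ (ℕ.+-cancelʳ-≡ a t (suc s) (trans (sym e) (ℕ.+-suc s a)))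

-- Boolean tests and the propositions they decide

T-ext : ∀ {a b} → (T a → T b) → (T b → T a) → a ≡ b
T-ext {false} {false} f g = refl
T-ext {false} {true}  f g = ⊥-elim (g _)
T-ext {true}  {false} f g = ⊥-elim (f _)
T-ext {true}  {true}  f g = refl

T⇒≡true : ∀ {a} → T a → a ≡ true
T⇒≡true {true} _ = refl

¬T⇒≡false : ∀ {a} → ¬ T a → a ≡ false
¬T⇒≡false {false} _  = refl
¬T⇒≡false {true}  ¬t = ⊥-elim (¬t _)

T-→⁺ : ∀ {a b} → (T a → T b) → T (not a ∨ b)
T-→⁺ {false} f = _
T-→⁺ {true}  f = f _

T-→⁻ : ∀ {a b} → T (not a ∨ b) → T a → T b
T-→⁻ {true} t _ = t

T-∧⁺ : ∀ {a b} → T a → T b → T (a ∧ b)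
T-∧⁺ p q = Equivalence.from T-∧ (p , q)

T-∧⁻ : ∀ {a b} → T (a ∧ b) → T a × T b
T-∧⁻ = Equivalence.to T-∧

allB-allFin⁺ : ∀ {p : Fin m → Bool} → (∀ i → T (p i)) → T (allB p (allFin m))
allB-allFin⁺ {m} {p} h = go (allFin m)
  where
  go : ∀ xs → T (allB p xs)
  go []       = _
  go (x ∷ xs) = T-∧⁺ (h x) (go xs)

allB-allFin⁻ : ∀ {p : Fin m → Bool} → T (allB p (allFin m)) → ∀ i → T (p i)
allB-allFin⁻ {m} {p} t i = go t (∈-allFin i)
  where
  go : ∀ {xs} → T (allB p xs) → i ∈ xs → T (p i)
  go t (here refl) = proj₁ (T-∧⁻ t)
  go t (there i∈)    = go (proj₂ (T-∧⁻ t)) i∈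

𝟙 : Bool → ℕ
𝟙 b = if b then 1 else 0

chain⁺ : ∀ {a b c d e f} → a < b → c < d → e < f → T ((a <ᵇ b) ∧ (c <ᵇ d) ∧ (e <ᵇ f))
chain⁺ p q r = T-∧⁺ (ℕ.<⇒<ᵇ p) (T-∧⁺ (ℕ.<⇒<ᵇ q) (ℕ.<⇒<ᵇ r))

chain⁻ : ∀ (a b c d e f : Fin m) → T ((a <F b) ∧ (c <F d) ∧ (e <F f)) → a <ᶠ b × c <ᶠ d × e <ᶠ f
chain⁻ a b c d e f t with p , s ← T-∧⁻ {a <F b} t with q , r ← T-∧⁻ {c <F d} s =
  ℕ.<ᵇ⇒< _ _ p , ℕ.<ᵇ⇒< _ _ q , ℕ.<ᵇ⇒< _ _ r

<ᵇ-true : ∀ {a b} → a < b → (a <ᵇ b) ≡ true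
<ᵇ-true p = T⇒≡true (ℕ.<⇒<ᵇ p)

<ᵇ-false : ∀ {a b} → ¬ a < b → (a <ᵇ b) ≡ false
<ᵇ-false ¬p = ¬T⇒≡false (¬p ∘ ℕ.<ᵇ⇒< _ _)

-- Permutations as vectors of images

Inj : Vec (Fin m) m → Set
Inj v = Injective _≡_ _≡_ (σ v)

-- A missed `y` could be punched out of the codomain, which would inject `suc m` elements into `m`.
injective⇒surjective : ∀ {f : Fin m → Fin m} → Injective _≡_ _≡_ f → ∀ y → ∃ λ x → f x ≡ y
injective⇒surjective {suc m} {f} inj y with any? (λ x → f x ≟ y)
... | yes hit = hit
... | no miss = contradiction
        (injective⇒≤ {f = λ x → punchOut (y≢f x)} λ {a} {b} e →
          inj (punchOut-injective (y≢f a) (y≢f b) e))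
        ℕ.1+n≰n
  where
  y≢f : ∀ x → y ≢ f x
  y≢f x e = miss (x , sym e)

module _ (v : Vec (Fin m) m) where

  -- The preimage `j` in the list keeps the search from falling back on its default value `i`.
  findPre-correct : ∀ {i j js} → σ v j ≡ i → j ∈ js → σ v (findPre v i js) ≡ i
  findPre-correct {i} {j} {j' ∷ js} e j∈ with toℕ (σ v j') ≡ᵇ toℕ i in eq
  ... | true = toℕ-injective (ℕ.≡ᵇ⇒≡ _ _ (subst T (sym eq) _))
  findPre-correct {i} {j} {_ ∷ js} e (here refl) | false =
    ⊥-elim (subst T eq (ℕ.≡⇒≡ᵇ _ _ (cong toℕ e)))
  findPre-correct {i} {j} {_ ∷ js} e (there j∈) | false = findPre-correct e j∈

  σ∘σ⁻¹ : Inj v → ∀ i → σ v (σ⁻¹ v i) ≡ i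
  σ∘σ⁻¹ inj i with j , e ← injective⇒surjective inj i = findPre-correct e (∈-allFin j)

  σ⁻¹-unique : Inj v → ∀ {i j} → σ v j ≡ i → σ⁻¹ v i ≡ j
  σ⁻¹-unique inj e = inj (trans (σ∘σ⁻¹ inj _) (sym e))

  record⁺ : ∀ {i} → (∀ j → j <ᶠ i → σ v j <ᶠ σ v i) → T (isRecord v i)
  record⁺ {i} h = allB-allFin⁺ λ j → T-→⁺ {j <F i} λ t → ℕ.<⇒<ᵇ (h j (ℕ.<ᵇ⇒< _ _ t))

  record⁻ : ∀ {i} → T (isRecord v i) → ∀ j → j <ᶠ i → σ v j <ᶠ σ v i
  record⁻ {i} t j p = ℕ.<ᵇ⇒< _ _ (T-→⁻ {j <F i} (allB-allFin⁻ t j) (ℕ.<⇒<ᵇ p))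

  antirecord⁺ : ∀ {i} → (∀ j → i <ᶠ j → σ v i <ᶠ σ v j) → T (isAntirecord v i)
  antirecord⁺ {i} h = allB-allFin⁺ λ j → T-→⁺ {i <F j} λ t → ℕ.<⇒<ᵇ (h j (ℕ.<ᵇ⇒< _ _ t))

  antirecord⁻ : ∀ {i} → T (isAntirecord v i) → ∀ j → i <ᶠ j → σ v i <ᶠ σ v j
  antirecord⁻ {i} t j p = ℕ.<ᵇ⇒< _ _ (T-→⁻ {i <F j} (allB-allFin⁻ t j) (ℕ.<⇒<ᵇ p))

-- Exchanging two values

transpose-left : ∀ (k k' : Fin m) → transpose k k' k ≡ k'
transpose-left k k' with k ≟ k
... | yes _  = refl
... | no k≢k = contradiction refl k≢k

transpose-right : ∀ (k k' : Fin m) → transpose k k' k' ≡ k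
transpose-right k k' with k' ≟ k
... | yes k'≡k = k'≡k
... | no _ with k' ≟ k'
...   | yes _    = refl
...   | no k'≢k' = contradiction refl k'≢k'

transpose-other : ∀ {k k' j : Fin m} → j ≢ k → j ≢ k' → transpose k k' j ≡ j
transpose-other {k = k} {k'} {j} j≢k j≢k' with j ≟ k
... | yes j≡k = contradiction j≡k j≢k
... | no _ with j ≟ k'
...   | yes j≡k' = contradiction j≡k' j≢k'
...   | no _     = refl

transpose-involutive : ∀ (k k' : Fin m) → IsInvolution (transpose k k')
transpose-involutive k k' j with j ≟ k
... | yes refl = transpose-right k k'
... | no j≢k with j ≟ k'
...   | yes refl = transpose-left k k'
...   | no j≢k'    = transpose-other j≢k j≢k'

<⇒≢ : ∀ {i j : Fin m} → i <ᶠ j → i ≢ j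
<⇒≢ p refl = ℕ.<-irrefl refl p

>⇒≢ : ∀ {i j : Fin m} → j <ᶠ i → i ≢ j
>⇒≢ p refl = ℕ.<-irrefl refl p

-- k and k' are the only positions ≥ k with values < k, no position > k has
-- value k (so k is a cycle peak), and v' is v with these two values exchanged.
record Swap {m} (v v' : Vec (Fin m) m) (k k' : Fin m) : Set where
  field
    inj     : Inj v
    k<k'    : k <ᶠ k'
    low     : σ v k <ᶠ k
    low'    : σ v k' <ᶠ k
    high    : ∀ {j} → k <ᶠ j → j ≢ k' → k <ᶠ σ v j
    swapped : ∀ j → σ v' j ≡ σ v (transpose k k' j)

  at-k : σ v' k ≡ σ v k'
  at-k = trans (swapped k) (cong (σ v) (transpose-left k k'))

  at-k' : σ v' k' ≡ σ v k
  at-k' = trans (swapped k') (cong (σ v) (transpose-right k k'))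

  at-other : ∀ {j} → j ≢ k → j ≢ k' → σ v' j ≡ σ v j
  at-other p q = trans (swapped _) (cong (σ v) (transpose-other p q))

-- Both exchanged values lie below `k`, so the conditions are symmetric. `OneWay` can therefore
-- prove mere implications, which `BothWays` turns into equivalences.
swap-sym : ∀ {v v' : Vec (Fin m) m} {k k'} → Swap v v' k k' → Swap v' v k k'
swap-sym {v = v} {v'} {k} {k'} s = record
  { inj     = λ {i} {j} e → begin
      i                                     ≡⟨ transpose-involutive k k' i ⟨
      τ (τ i)  ≡⟨ cong τ (inj (trans (sym (swapped i)) (trans e (swapped j)))) ⟩
      τ (τ j)  ≡⟨ transpose-involutive k k' j ⟩
      j        ∎
  ; k<k'    = k<k'
  ; low     = subst (_<ᶠ k) (sym at-k) low'
  ; low'    = subst (_<ᶠ k) (sym at-k') low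
  ; high    = λ k<j j≢k' → subst (k <ᶠ_) (sym (at-other (>⇒≢ k<j) j≢k')) (high k<j j≢k')
  ; swapped = λ j → sym (trans (swapped (τ j)) (cong (σ v) (transpose-involutive k k' j)))
  }
  where
  open Swap s
  open ≡-Reasoning
  τ = transpose k k'

-- Values, records and arcs under an exchange

module OneWay {v v' : Vec (Fin m) m} {k k'} (s : Swap v v' k k') where
  open Swap s

  data Position (i : Fin m) : Set where
    is-k  : i ≡ k → Position i
    is-k' : i ≡ k' → Position i
    other : i ≢ k → i ≢ k' → Position i

  position : ∀ i → Position i
  position i with i ≟ k | i ≟ k'
  ... | yes p | _     = is-k p
  ... | no _  | yes q = is-k' q
  ... | no p  | no q  = other p q

  -- Both exchanged positions lie above their values, so no upper arc is touched.
  excedance-fixed : ∀ {i} → i <ᶠ σ v i → σ v' i ≡ σ v i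
  excedance-fixed {i} p with position i
  ... | is-k refl  = contradiction p (<-asym low)
  ... | is-k' refl = contradiction p (<-asym (<-trans low' k<k'))
  ... | other a b    = at-other a b

  -- The value `k` is not taken at `k` or `k'`, whose values are below `k`, nor at another later
  -- position, whose value is above `k`. Together with `low` this makes `k` a cycle peak.
  σ⁻¹k<k : σ⁻¹ v k <ᶠ k
  σ⁻¹k<k with <-cmp (σ⁻¹ v k) k | σ∘σ⁻¹ v inj k
  ... | tri< p _ _ | _ = p
  ... | tri≈ _ p _ | e = contradiction (trans (cong (σ v) (sym p)) e) (<⇒≢ low)
  ... | tri> _ _ p | e with σ⁻¹ v k ≟ k'
  ...   | yes q = contradiction (trans (cong (σ v) (sym q)) e) (<⇒≢ low')
  ...   | no q  = contradiction (sym e) (<⇒≢ (high p q))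

  -- The cycle type of `i` depends only on the sides on which its image and preimage lie. The
  -- exchanged values stay below `k`, hence below both positions.
  σ-same-side : ∀ i → σ v' i ≡ σ v i ⊎ (σ v i <ᶠ i × σ v' i <ᶠ i)
  σ-same-side i with position i
  ... | is-k refl  = inj₂ (low , subst (_<ᶠ k) (sym at-k) low')
  ... | is-k' refl = inj₂ (<-trans low' k<k' , subst (_<ᶠ k') (sym at-k') (<-trans low k<k'))
  ... | other p q    = inj₁ (at-other p q)

  -- The two exchanged values trade the preimages `k` and `k'`, and both of these lie above both
  -- values.
  σ⁻¹-same-side : ∀ i → σ⁻¹ v' i ≡ σ⁻¹ v i ⊎ (i <ᶠ σ⁻¹ v i × i <ᶠ σ⁻¹ v' i)
  σ⁻¹-same-side i with position (σ⁻¹ v i) | σ∘σ⁻¹ v inj i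
  ... | is-k p    | e = inj₂
    ( subst (_<ᶠ σ⁻¹ v i) vk≡i (subst (σ v k <ᶠ_) (sym p) low)
    , subst (_<ᶠ σ⁻¹ v' i) vk≡i (subst (σ v k <ᶠ_) (sym inv') (<-trans low k<k')) )
    where
    vk≡i = trans (cong (σ v) (sym p)) e
    inv' = σ⁻¹-unique v' (Swap.inj (swap-sym s)) (trans at-k' vk≡i)
  ... | is-k' p   | e = inj₂
    ( subst (_<ᶠ σ⁻¹ v i) vk'≡i (subst (σ v k' <ᶠ_) (sym p) (<-trans low' k<k'))
    , subst (_<ᶠ σ⁻¹ v' i) vk'≡i (subst (σ v k' <ᶠ_) (sym inv') low') )
    where
    vk'≡i = trans (cong (σ v) (sym p)) e
    inv' = σ⁻¹-unique v' (Swap.inj (swap-sym s)) (trans at-k vk'≡i)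
  ... | other p q | e = inj₁ (σ⁻¹-unique v' (Swap.inj (swap-sym s)) (trans (at-other p q) e))

  -- Neither `k` nor `k'` is a record, because the value `k` is taken before them. A record further
  -- on has a value above `k`, which exceeds both exchanged values.
  record-swap : ∀ i → T (isRecord v i) → T (isRecord v' i)
  record-swap i t with position i | record⁻ v {i} t
  ... | is-k refl  | h =
    contradiction (<-trans (subst (_<ᶠ σ v k) (σ∘σ⁻¹ v inj k) (h _ σ⁻¹k<k)) low) (<-irrefl refl)
  ... | is-k' refl | h =
    contradiction (<-trans (subst (_<ᶠ σ v k') (σ∘σ⁻¹ v inj k) (h _ (<-trans σ⁻¹k<k k<k'))) low')
      (<-irrefl refl)
  ... | other a b    | h = record⁺ v' λ j j<i → subst (σ v' j <ᶠ_) (sym (at-other a b)) (go j j<i)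
    where
    go : ∀ j → j <ᶠ i → σ v' j <ᶠ σ v i
    go j j<i with position j
    ... | is-k refl  = <-trans (subst (_<ᶠ k) (sym at-k) low') (high j<i b)
    ... | is-k' refl = <-trans (subst (_<ᶠ k) (sym at-k') low) (high (<-trans k<k' j<i) b)
    ... | other c d    = subst (_<ᶠ σ v i) (sym (at-other c d)) (h j j<i)

  -- For `i` before `k`, both exchanged positions come later, so the set of later values is
  -- unchanged. The position `k'` is an antirecord anyway, since all values after it exceed `k`.
  antirecord-swap : ∀ i → i ≢ k → T (isAntirecord v i) → T (isAntirecord v' i)
  antirecord-swap i i≢k t with <-cmp i k | antirecord⁻ v {i} t
  ... | tri≈ _ p _ | _ = contradiction p i≢k
  ... | tri< i<k _ _ | h = antirecord⁺ v' λ j i<j →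
    subst₂ _<ᶠ_ (sym (at-other i≢k (<⇒≢ (<-trans i<k k<k')))) (sym (swapped j)) (h _ (τ> j i<j))
    where
    τ> : ∀ j → i <ᶠ j → i <ᶠ transpose k k' j
    τ> j i<j with position j
    ... | is-k refl  = subst (i <ᶠ_) (sym (transpose-left k k')) (<-trans i<k k<k')
    ... | is-k' refl = subst (i <ᶠ_) (sym (transpose-right k k')) i<k
    ... | other c d    = subst (i <ᶠ_) (sym (transpose-other c d)) i<j
  ... | tri> _ _ k<i | h with i ≟ k'
  ...   | yes refl = antirecord⁺ v' λ j i<j → <-trans (subst (_<ᶠ k) (sym at-k') low)
           (Swap.high (swap-sym s) (<-trans k<k' i<j) (>⇒≢ i<j))
  ...   | no i≢k' = antirecord⁺ v' go
    where
    go : ∀ j → i <ᶠ j → σ v' i <ᶠ σ v' j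
    go j i<j with j ≟ k'
    -- With `k'` after it, `i` is no antirecord: its value is above `k` and that of `k'` is below.
    ... | yes refl = contradiction (<-trans (<-trans (h k' i<j) low') (high k<i i≢k')) (<-irrefl refl)
    ... | no j≢k'    =
      subst₂ _<ᶠ_ (sym (at-other i≢k i≢k')) (sym (at-other (>⇒≢ (<-trans k<i i<j)) j≢k')) (h j i<j)

  -- All later values except that of `k'` exceed `k`, so the comparison with `k'` decides, and the
  -- exchange reverses this comparison.
  antirecord-k⁺ : σ v k <ᶠ σ v k' → T (isAntirecord v k)
  antirecord-k⁺ p = antirecord⁺ v go
    where
    go : ∀ j → k <ᶠ j → σ v k <ᶠ σ v j
    go j k<j with j ≟ k'
    ... | yes refl = p
    ... | no j≢k'    = <-trans low (high k<j j≢k')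

  antirecord-k⁻ : T (isAntirecord v k) → σ v k <ᶠ σ v k'
  antirecord-k⁻ t = antirecord⁻ v {k} t k' k<k'

  lnestP lcrossP ucrossP unestP : Vec (Fin m) m → Fin m → Fin m → Bool
  lnestP  u i j = (i <F j) ∧ (σ u i <F i) ∧ (σ u j <F σ u i)
  lcrossP u i j = (i <F j) ∧ (σ u j <F i) ∧ (σ u i <F σ u j)
  ucrossP u i j = (j <F i) ∧ (i <F σ u j) ∧ (σ u j <F σ u i)
  unestP  u i j = (j <F i) ∧ (i <F σ u i) ∧ (σ u i <F σ u j)

  ucross-swap : ∀ i j → T (ucrossP v i j) → T (ucrossP v' i j)
  ucross-swap i j t with a , b , c ← chain⁻ j i i (σ v j) (σ v j) (σ v i) t
    rewrite excedance-fixed (<-trans b c) | excedance-fixed (<-trans a b) = t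

  unest-swap : ∀ i j → T (unestP v i j) → T (unestP v' i j)
  unest-swap i j t with a , b , c ← chain⁻ j i i (σ v i) (σ v i) (σ v j) t
    rewrite excedance-fixed b | excedance-fixed (<-trans a (<-trans b c)) = t

  -- Here `i` cannot be `k'`, as values after `k'` exceed `k`. If `j` is `k'`, its old and new
  -- values are both below `k`, hence below that of `i`.
  lnest-swap : ∀ i j → k <ᶠ i → T (lnestP v i j) → T (lnestP v' i j)
  lnest-swap i j k<i t with a , b , c ← chain⁻ i j (σ v i) i (σ v j) (σ v i) t with i ≟ k'
  ... | yes refl = contradiction (<-trans (high (<-trans k<k' a) (>⇒≢ a)) (<-trans c low')) (<-irrefl refl)
  ... | no i≢k' with j ≟ k'
  ...   | yes refl rewrite at-other (>⇒≢ k<i) i≢k' | at-k' = chain⁺ a b (<-trans low (high k<i i≢k'))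
  ...   | no j≢k' rewrite at-other (>⇒≢ k<i) i≢k' | at-other (>⇒≢ (<-trans k<i a)) j≢k' = t

  -- If `i` is `k'`, its old and new values are both below `k`, hence below that of `j`. Otherwise
  -- `j` cannot be `k'`, as the value of `i` exceeds `k`.
  lcross-swap : ∀ i j → k <ᶠ i → T (lcrossP v i j) → T (lcrossP v' i j)
  lcross-swap i j k<i t with a , b , c ← chain⁻ i j (σ v j) i (σ v i) (σ v j) t with i ≟ k'
  ... | yes refl rewrite at-k' | at-other (>⇒≢ (<-trans k<k' a)) (>⇒≢ a) =
    chain⁺ a b (<-trans low (high (<-trans k<k' a) (>⇒≢ a)))
  ... | no i≢k' with j ≟ k'
  ...   | yes refl = contradiction (<-trans (high k<i i≢k') (<-trans c low')) (<-irrefl refl)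
  ...   | no j≢k' rewrite at-other (>⇒≢ k<i) i≢k' | at-other (>⇒≢ (<-trans k<i a)) j≢k' = t

  -- Every later position other than `k'` has a value above `k`, so only `k'` can contribute.
  lnestAt-k : lnestAt v k ≡ 𝟙 (σ v k' <F σ v k)
  lnestAt-k = trans (∑-supportedAt k' off) (cong 𝟙 at)
    where
    off : ∀ j → j ≢ k' → 𝟙 (lnestP v k j) ≡ 0
    off j j≢k' = cong 𝟙 (¬T⇒≡false λ t → let a , b , c = chain⁻ k j (σ v k) k (σ v j) (σ v k) t in
      <-irrefl refl (<-trans (high a j≢k') (<-trans c low)))
    at : lnestP v k k' ≡ (σ v k' <F σ v k)
    at rewrite <ᵇ-true k<k' | <ᵇ-true low = refl

  lcrossAt-k : lcrossAt v k ≡ 𝟙 (σ v k <F σ v k')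
  lcrossAt-k = trans (∑-supportedAt k' off) (cong 𝟙 at)
    where
    off : ∀ j → j ≢ k' → 𝟙 (lcrossP v k j) ≡ 0
    off j j≢k' = cong 𝟙 (¬T⇒≡false λ t → let a , b , c = chain⁻ k j (σ v j) k (σ v k) (σ v j) t in
      <-irrefl refl (<-trans (high a j≢k') b))
    at : lcrossP v k k' ≡ (σ v k <F σ v k')
    at rewrite <ᵇ-true k<k' | <ᵇ-true low' = refl

𝟙-adjacent : ∀ {a b : Fin m} → a ≢ b → Adjacent (𝟙 (a <F b)) (𝟙 (b <F a))
𝟙-adjacent {a = a} {b} a≢b with <-cmp a b
... | tri< p _ q rewrite <ᵇ-true p | <ᵇ-false q = inj₁ refl
... | tri≈ _ p _ = contradiction p a≢b
... | tri> p _ q rewrite <ᵇ-true q | <ᵇ-false p = inj₂ refl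

module BothWays {v v' : Vec (Fin m) m} {k k'} (s : Swap v v' k k') where
  open Swap s
  open OneWay s
  private
    module ↔ = OneWay (swap-sym s)
    s' = swap-sym s

  σ<-swap : ∀ i → (σ v i <F i) ≡ (σ v' i <F i)
  σ<-swap i with σ-same-side i
  ... | inj₁ e       = cong (_<F i) (sym e)
  ... | inj₂ (p , q) = trans (<ᵇ-true p) (sym (<ᵇ-true q))

  <σ-swap : ∀ i → (i <F σ v i) ≡ (i <F σ v' i)
  <σ-swap i with σ-same-side i
  ... | inj₁ e       = cong (i <F_) (sym e)
  ... | inj₂ (p , q) = trans (<ᵇ-false (<-asym p)) (sym (<ᵇ-false (<-asym q)))

  σ⁻¹<-swap : ∀ i → (σ⁻¹ v i <F i) ≡ (σ⁻¹ v' i <F i)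
  σ⁻¹<-swap i with σ⁻¹-same-side i
  ... | inj₁ e       = cong (_<F i) (sym e)
  ... | inj₂ (p , q) = trans (<ᵇ-false (<-asym p)) (sym (<ᵇ-false (<-asym q)))

  <σ⁻¹-swap : ∀ i → (i <F σ⁻¹ v i) ≡ (i <F σ⁻¹ v' i)
  <σ⁻¹-swap i with σ⁻¹-same-side i
  ... | inj₁ e       = cong (i <F_) (sym e)
  ... | inj₂ (p , q) = trans (<ᵇ-true p) (sym (<ᵇ-true q))

  isCPeak-swap : ∀ i → isCPeak v i ≡ isCPeak v' i
  isCPeak-swap i = cong₂ _∧_ (σ⁻¹<-swap i) (σ<-swap i)

  isCVal-swap : ∀ i → isCVal v i ≡ isCVal v' i
  isCVal-swap i = cong₂ _∧_ (<σ⁻¹-swap i) (<σ-swap i)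

  isCDRise-swap : ∀ i → isCDRise v i ≡ isCDRise v' i
  isCDRise-swap i = cong₂ _∧_ (σ⁻¹<-swap i) (<σ-swap i)

  isCDFall-swap : ∀ i → isCDFall v i ≡ isCDFall v' i
  isCDFall-swap i = cong₂ _∧_ (<σ⁻¹-swap i) (σ<-swap i)

  isCPeak-k : isCPeak v k ≡ true
  isCPeak-k rewrite <ᵇ-true σ⁻¹k<k | <ᵇ-true low = refl

  isRecord-swap : ∀ i → isRecord v i ≡ isRecord v' i
  isRecord-swap i = T-ext (record-swap i) (↔.record-swap i)

  isAntirecord-swap : ∀ i → i ≢ k → isAntirecord v i ≡ isAntirecord v' i
  isAntirecord-swap i i≢k = T-ext (antirecord-swap i i≢k) (↔.antirecord-swap i i≢k)

  σk≢σk' : σ v k ≢ σ v k'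
  σk≢σk' e = <⇒≢ k<k' (inj e)

  isAntirecord-k : isAntirecord v k ≡ (σ v k <F σ v k')
  isAntirecord-k = T-ext (ℕ.<⇒<ᵇ ∘ antirecord-k⁻) (antirecord-k⁺ ∘ ℕ.<ᵇ⇒< _ _)

  isAntirecord'-k : isAntirecord v' k ≡ (σ v k' <F σ v k)
  isAntirecord'-k = trans
    (T-ext (ℕ.<⇒<ᵇ ∘ ↔.antirecord-k⁻) (↔.antirecord-k⁺ ∘ ℕ.<ᵇ⇒< _ _))
    (cong₂ _<F_ at-k at-k')

  isRecord-k : isRecord v k ≡ false
  isRecord-k = ¬T⇒≡false λ t →
    <-irrefl refl (<-trans (subst (_<ᶠ σ v k) (σ∘σ⁻¹ v inj k) (record⁻ v {k} t _ σ⁻¹k<k)) low)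

  -- Only the term at the cycle peak `k` changes: `k` is not a record, and it is an antirecord in
  -- exactly one of the two vectors.
  nrcpeak-swap : Adjacent (nrcpeak v) (nrcpeak v')
  nrcpeak-swap = ∑-adjacent k off at
    where
    off : ∀ i → i ≢ k → 𝟙 (isCPeak v i ∧ not (isRecord v i) ∧ not (isAntirecord v i))
                      ≡ 𝟙 (isCPeak v' i ∧ not (isRecord v' i) ∧ not (isAntirecord v' i))
    off i i≢k rewrite isCPeak-swap i | isRecord-swap i | isAntirecord-swap i i≢k = refl
    at : Adjacent (𝟙 (isCPeak v k ∧ not (isRecord v k) ∧ not (isAntirecord v k)))
                  (𝟙 (isCPeak v' k ∧ not (isRecord v' k) ∧ not (isAntirecord v' k)))
    at rewrite sym (isCPeak-swap k) | isCPeak-k | sym (isRecord-swap k) | isRecord-k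
             | isAntirecord-k | isAntirecord'-k with <-cmp (σ v k) (σ v k')
    ... | tri< p _ q rewrite <ᵇ-true p | <ᵇ-false q = inj₂ refl
    ... | tri≈ _ p _ = contradiction p σk≢σk'
    ... | tri> p _ q rewrite <ᵇ-true q | <ᵇ-false p = inj₁ refl

  -- The antirecord property can change only at `k`, where the term vanishes because `P` fails.
  nr-swap : ∀ {P P' : Fin m → Bool} → (∀ i → P i ≡ P' i) → P k ≡ false → nr v P ≡ nr v' P'
  nr-swap {P} {P'} P≡P' Pk = ∑-cong same (allFin m)
    where
    same : ∀ i → 𝟙 (P i ∧ not (isRecord v i) ∧ not (isAntirecord v i))
               ≡ 𝟙 (P' i ∧ not (isRecord v' i) ∧ not (isAntirecord v' i))
    same i with i ≟ k
    ... | yes refl rewrite sym (P≡P' i) | Pk = refl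
    ... | no i≢k rewrite P≡P' i | isRecord-swap i | isAntirecord-swap i i≢k = refl

  nrcval-swap : nrcval v ≡ nrcval v'
  nrcval-swap = nr-swap isCVal-swap (cong (_∧ (k <F σ v k)) (<ᵇ-false (<-asym σ⁻¹k<k)))

  nrcdfall-swap : nrcdfall v ≡ nrcdfall v'
  nrcdfall-swap = nr-swap isCDFall-swap (cong (_∧ (σ v k <F k)) (<ᵇ-false (<-asym σ⁻¹k<k)))

  nrcdrise-swap : nrcdrise v ≡ nrcdrise v'
  nrcdrise-swap = nr-swap isCDRise-swap (cong₂ _∧_ (<ᵇ-true σ⁻¹k<k) (<ᵇ-false (<-asym low)))

  ucrossAt-swap : ∀ i → ucrossAt v i ≡ ucrossAt v' i
  ucrossAt-swap i = ∑-cong (λ j → cong 𝟙 (T-ext (ucross-swap i j) (↔.ucross-swap i j))) (allFin m)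

  unestAt-swap : ∀ i → unestAt v i ≡ unestAt v' i
  unestAt-swap i = ∑-cong (λ j → cong 𝟙 (T-ext (unest-swap i j) (↔.unest-swap i j))) (allFin m)

  -- For `i` before `k` both exchanged positions come after `i`. Transposing the summation index
  -- thus carries the count at `i` for `v` to the one for `v'`.
  <F-transpose : ∀ {i} → i <ᶠ k → ∀ j → (i <F transpose k k' j) ≡ (i <F j)
  <F-transpose i<k j with position j
  ... | is-k refl  rewrite transpose-left k k' = trans (<ᵇ-true (<-trans i<k k<k')) (sym (<ᵇ-true i<k))
  ... | is-k' refl rewrite transpose-right k k' = trans (<ᵇ-true i<k) (sym (<ᵇ-true (<-trans i<k k<k')))
  ... | other p q    rewrite transpose-other p q = refl

  lnestAt-swap : ∀ i → i ≢ k → lnestAt v i ≡ lnestAt v' i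
  lnestAt-swap i i≢k with <-cmp i k
  ... | tri≈ _ p _   = contradiction p i≢k
  ... | tri> _ _ k<i = ∑-cong (λ j → cong 𝟙 (T-ext (lnest-swap i j k<i) (↔.lnest-swap i j k<i))) (allFin m)
  ... | tri< i<k _ _ = trans
    (∑-involution _ (allFin⁺ m) ∈-allFin (transpose k k') (transpose-involutive k k'))
    (∑-cong (λ j → cong 𝟙 (same j)) (allFin m))
    where
    same : ∀ j → lnestP v i (transpose k k' j) ≡ lnestP v' i j
    same j rewrite <F-transpose i<k j | swapped j | at-other i≢k (<⇒≢ (<-trans i<k k<k')) = refl

  lcrossAt-swap : ∀ i → i ≢ k → lcrossAt v i ≡ lcrossAt v' i
  lcrossAt-swap i i≢k with <-cmp i k
  ... | tri≈ _ p _   = contradiction p i≢k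
  ... | tri> _ _ k<i = ∑-cong (λ j → cong 𝟙 (T-ext (lcross-swap i j k<i) (↔.lcross-swap i j k<i))) (allFin m)
  ... | tri< i<k _ _ = trans
    (∑-involution _ (allFin⁺ m) ∈-allFin (transpose k k') (transpose-involutive k k'))
    (∑-cong (λ j → cong 𝟙 (same j)) (allFin m))
    where
    same : ∀ j → lcrossP v i (transpose k k' j) ≡ lcrossP v' i j
    same j rewrite <F-transpose i<k j | swapped j | at-other i≢k (<⇒≢ (<-trans i<k k<k')) = refl

  -- The two values are compared in opposite orders before and after, so one count is 1 and the
  -- other 0.
  lnestAt-k-swap : Adjacent (lnestAt v k) (lnestAt v' k)
  lnestAt-k-swap rewrite lnestAt-k | ↔.lnestAt-k | at-k | at-k' = 𝟙-adjacent (≢-sym σk≢σk')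

  lcrossAt-k-swap : Adjacent (lcrossAt v k) (lcrossAt v' k)
  lcrossAt-k-swap rewrite lcrossAt-k | ↔.lcrossAt-k | at-k | at-k' = 𝟙-adjacent σk≢σk'

  sumOver-adjacent : ∀ {P P' : Fin m → Bool} {f f' : Fin m → ℕ} → (∀ i → P i ≡ P' i) → P k ≡ true →
                     (∀ i → i ≢ k → f i ≡ f' i) → Adjacent (f k) (f' k) →
                     Adjacent (sumOver v P f) (sumOver v' P' f')
  sumOver-adjacent {P} {P'} {f} {f'} P≡P' Pk same adj =
    ∑-adjacent k (λ i i≢k → cong₂ (λ b x → if b then x else 0) (P≡P' i) (same i i≢k)) at
    where
    at : Adjacent (if P k then f k else 0) (if P' k then f' k else 0)
    at rewrite sym (P≡P' k) | Pk = adj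

  lnest-adjacent : Adjacent (lnest v) (lnest v')
  lnest-adjacent = sumOver-adjacent (λ _ → refl) refl lnestAt-swap lnestAt-k-swap

  lcross-adjacent : Adjacent (lcross v) (lcross v')
  lcross-adjacent = sumOver-adjacent (λ _ → refl) refl lcrossAt-swap lcrossAt-k-swap

-- The statistics with one summand that the exchange changes by one, all other summands being
-- invariant. The purely upper ones are reached through `Dual`.
data Lower : StatName → Set where
  l-nrcpeak     : Lower s-nrcpeak
  l-nrcAll      : Lower s-nrcAll
  l-lcrosscpeak : Lower s-lcrosscpeak
  l-lnestcpeak  : Lower s-lnestcpeak
  l-lcross      : Lower s-lcross
  l-lnest       : Lower s-lnest
  l-cross       : Lower s-cross
  l-nest        : Lower s-nest

stat-swap : ∀ {s} → Lower s → {v v' : Vec (Fin m) m} {k k' : Fin m} →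
            Swap v v' k k' → Adjacent (stat s v) (stat s v')
stat-swap {m} l {v} {v'} sw = go l
  where
  open BothWays sw
  go : ∀ {s} → Lower s → Adjacent (stat s v) (stat s v')
  go l-nrcpeak     = nrcpeak-swap
  go l-nrcAll      = +-adjacent (+-adjacent (+-adjacent nrcpeak-swap nrcval-swap) nrcdrise-swap) nrcdfall-swap
  go l-lcrosscpeak = sumOver-adjacent isCPeak-swap isCPeak-k lcrossAt-swap lcrossAt-k-swap
  go l-lnestcpeak  = sumOver-adjacent isCPeak-swap isCPeak-k lnestAt-swap lnestAt-k-swap
  go l-lcross      = lcross-adjacent
  go l-lnest       = lnest-adjacent
  go l-cross       = adjacent-+ (∑-cong ucrossAt-swap (allFin m)) lcross-adjacent
  go l-nest        = adjacent-+ (∑-cong unestAt-swap (allFin m)) lnest-adjacent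

lookup-ext : ∀ {A : Set} {u v : Vec A m} → (∀ i → lookup u i ≡ lookup v i) → u ≡ v
lookup-ext {u = u} {v} e = trans (sym (tabulate∘lookup u)) (trans (tabulate-cong e) (tabulate∘lookup v))

-- The sign-reversing involution

isPerm⁺ : ∀ (v : Vec (Fin m) m) → Inj v → T (isPerm v)
isPerm⁺ v inj = allB-allFin⁺ λ i → allB-allFin⁺ λ j → go i j
  where
  go : ∀ i j → T ((i ≡F j) ∨ not (app v i ≡F app v j))
  go i j with i ≡F j in p
  ... | true = _
  ... | false with app v i ≡F app v j in q
  ...   | false = _
  ...   | true  = subst T p (ℕ.≡⇒≡ᵇ _ _ (cong toℕ (inj (toℕ-injective (ℕ.≡ᵇ⇒≡ _ _ (subst T (sym q) _))))))

isPerm⁻ : ∀ (v : Vec (Fin m) m) → T (isPerm v) → Inj v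
isPerm⁻ v t {i} {j} e with i ≡F j in p | allB-allFin⁻ (allB-allFin⁻ t i) j
... | true  | _ = toℕ-injective (ℕ.≡ᵇ⇒≡ _ _ (subst T (sym p) _))
... | false | s = contradiction (subst (λ b → T (not b)) (T⇒≡true (ℕ.≡⇒≡ᵇ _ _ (cong toℕ e))) s) λ ()

module _ (v : Vec (Fin m) m) where

  -- Height at most one, put as uniqueness of the position so that nothing has to be counted.
  Narrow : ℕ → Set
  Narrow h = ∀ i j → h ≤ toℕ i → h ≤ toℕ j → toℕ (σ v i) < h → toℕ (σ v j) < h → i ≡ j

  Good : Set
  Good = ∀ h → Narrow h

  -- By `narrow`, `k` is the largest level of height above one, and at level `suc k` it leaves `k'`
  -- as the only position with a low value. Hence the pair is unique.
  record Crowded (k k' : Fin m) : Set where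
    constructor crowded
    field
      k<k'   : k <ᶠ k'
      low    : σ v k <ᶠ k
      low'   : σ v k' <ᶠ k
      narrow : ∀ h → toℕ k < h → Narrow h

  narrow? : ∀ h → Narrow h ⊎ ∃₂ λ i j → h ≤ toℕ i × h ≤ toℕ j × toℕ (σ v i) < h × toℕ (σ v j) < h × i ≢ j
  narrow? h with any? (λ i → any? (λ j → (h ℕ.≤? toℕ i) ×-dec (h ℕ.≤? toℕ j) ×-dec
                    (toℕ (σ v i) ℕ.<? h) ×-dec (toℕ (σ v j) ℕ.<? h) ×-dec ¬? (i ≟ j)))
  ... | yes w = inj₂ w
  ... | no ¬w = inj₁ narrow
    where
    narrow : Narrow h
    narrow i j a b c d with i ≟ j
    ... | yes e = e
    ... | no ¬e = contradiction (i , j , a , b , c , d , ¬e) ¬w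

  -- The search descends from level `m`, at and after which there are no positions.
  good-or-crowded : Good ⊎ ∃₂ Crowded
  good-or-crowded = descend m λ h m≤h i j h≤i → contradiction (ℕ.<-≤-trans (toℕ<n i) m≤h) (ℕ.≤⇒≯ h≤i)
    where
    descend : ∀ h → (∀ h' → h ≤ h' → Narrow h') → Good ⊎ ∃₂ Crowded
    descend zero    N = inj₁ λ h → N h z≤n
    descend (suc h) N with narrow? h
    ... | inj₁ narrow = descend h N'
      where
      N' : ∀ h' → h ≤ h' → Narrow h'
      N' h' h≤h' with ℕ.m≤n⇒m<n∨m≡n h≤h'
      ... | inj₁ h<h'   = N h' h<h'
      ... | inj₂ refl = narrow
    ... | inj₂ (i , j , h≤i , h≤j , σi<h , σj<h , i≢j)
        with ℕ.m≤n⇒m<n∨m≡n h≤i | ℕ.m≤n⇒m<n∨m≡n h≤j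
    ...   | inj₂ refl | _ = inj₂ (i , j , crowded (ℕ.≤∧≢⇒< h≤j (i≢j ∘ toℕ-injective)) σi<h σj<h N)
    ...   | inj₁ _ | inj₂ refl = inj₂ (j , i , crowded (ℕ.≤∧≢⇒< h≤i (i≢j ∘ sym ∘ toℕ-injective)) σj<h σi<h N)
    -- Two positions strictly after `h` would already violate narrowness at `suc h`, so one of the
    -- two is `h` itself.
    ...   | inj₁ h<i | inj₁ h<j = contradiction
            (N (suc h) ℕ.≤-refl i j h<i h<j (ℕ.m<n⇒m<1+n σi<h) (ℕ.m<n⇒m<1+n σj<h)) i≢j

  crowded⇒¬good : ∀ {k k'} → Crowded k k' → ¬ Good
  crowded⇒¬good {k} {k'} (crowded k<k' low low' _) good =
    <⇒≢ k<k' (good (toℕ k) k k' ℕ.≤-refl (ℕ.<⇒≤ k<k') low low')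

  crowded-unique : ∀ {k k' l l'} → Crowded k k' → Crowded l l' → k ≡ l × k' ≡ l'
  crowded-unique {k} {k'} {l} {l'} (crowded k<k' a b N) (crowded l<l' c d N') with <-cmp k l
  ... | tri< k<l _ _    = contradiction (N (toℕ l) k<l l l' ℕ.≤-refl (ℕ.<⇒≤ l<l') c d) (<⇒≢ l<l')
  ... | tri≈ _ refl _ = refl , N (suc (toℕ k)) ℕ.≤-refl k' l' k<k' l<l' (ℕ.m<n⇒m<1+n b) (ℕ.m<n⇒m<1+n d)
  ... | tri> _ _ l<k    = contradiction (N' (toℕ k) l<k k k' ℕ.≤-refl (ℕ.<⇒≤ k<k') a b) (<⇒≢ k<k')

exchange : Fin m → Fin m → Vec (Fin m) m → Vec (Fin m) m
exchange k k' v = tabulate (σ v ∘ transpose k k')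

exchange-involutive : ∀ (k k' : Fin m) → IsInvolution (exchange k k')
exchange-involutive k k' v = lookup-ext λ i → begin
  lookup (exchange k k' (exchange k k' v)) i     ≡⟨ lookup∘tabulate _ i ⟩
  lookup (exchange k k' v) (transpose k k' i)    ≡⟨ lookup∘tabulate _ (transpose k k' i) ⟩
  lookup v (transpose k k' (transpose k k' i))   ≡⟨ cong (lookup v) (transpose-involutive k k' i) ⟩
  lookup v i                                     ∎
  where open ≡-Reasoning

crowded⇒swap : ∀ {v : Vec (Fin m) m} {k k'} → Inj v → Crowded v k k' → Swap v (exchange k k' v) k k'
crowded⇒swap {v = v} {k} {k'} inj (crowded k<k' low low' N) = record
  { inj = inj ; k<k' = k<k' ; low = low ; low' = low'
  ; high = λ {j} k<j j≢k' → ℕ.≰⇒> λ σj≤k →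
      j≢k' (N (suc (toℕ k)) ℕ.≤-refl j k' k<j k<k' (s≤s σj≤k) (ℕ.m<n⇒m<1+n low'))
  ; swapped = lookup∘tabulate _
  }

-- Levels above `k` do not see the exchange: `k` lies before them, and `k'` has a value below `k` in
-- both vectors. So the same pair is found again.
crowded-exchange : ∀ {v v' : Vec (Fin m) m} {k k'} → Swap v v' k k' → Crowded v k k' → Crowded v' k k'
crowded-exchange {v = v} {v'} {k} {k'} s (crowded _ _ _ N) =
  crowded (Swap.k<k' s') (Swap.low s') (Swap.low' s') λ h k<h i j h≤i h≤j σi<h σj<h →
    N h k<h i j h≤i h≤j (below k<h h≤i σi<h) (below k<h h≤j σj<h)
  where
  s' = swap-sym s
  open Swap s
  below : ∀ {h i} → toℕ k < h → h ≤ toℕ i → toℕ (σ v' i) < h → toℕ (σ v i) < h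
  below {h} {i} k<h h≤i σ'i<h with i ≟ k'
  ... | yes refl = ℕ.<-trans low' k<h
  ... | no i≢k'    = subst (λ x → toℕ x < h) (at-other (>⇒≢ (ℕ.<-≤-trans k<h h≤i)) i≢k') σ'i<h

-- The D-condition sees only on which side of `i` its image lies.
isDPerm-swap : ∀ {v v' : Vec (Fin m) m} {k k'} → Swap v v' k k' → T (isDPerm v) → T (isDPerm v')
isDPerm-swap {v = v} {v'} s t = T-∧⁺ (isPerm⁺ v' (Swap.inj (swap-sym s))) (allB-allFin⁺ cond)
  where
  open BothWays s
  cond : ∀ i → T (if isEvenℕ (toℕ i) then not (app v' i <F i) else not (i <F app v' i))
  cond i rewrite sym (σ<-swap i) | sym (<σ-swap i) = allB-allFin⁻ (proj₂ (T-∧⁻ {isPerm v} t)) i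

𝔇-injective : ∀ n (d : 𝔇 n) → Inj (proj₁ d)
𝔇-injective n (v , t) = isPerm⁻ v (proj₁ (T-∧⁻ {isPerm v} t))

𝔇-≡ : ∀ n {d e : 𝔇 n} → proj₁ d ≡ proj₁ e → d ≡ e
𝔇-≡ n {v , p} {.v , q} refl = cong (v ,_) (T-irrelevant p q)

toggle : ∀ n → 𝔇 n → 𝔇 n
toggle n d@(v , t) with good-or-crowded v
... | inj₁ _            = d
... | inj₂ (k , k' , c) = exchange k k' v , isDPerm-swap (crowded⇒swap (𝔇-injective n d) c) t

toggle-involutive : ∀ n → IsInvolution (toggle n)
toggle-involutive n d@(v , t) with good-or-crowded v in eq
... | inj₁ _ rewrite eq = refl
... | inj₂ (k , k' , c) with good-or-crowded (exchange k k' v)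
                           | crowded-exchange (crowded⇒swap (𝔇-injective n d) c) c
...   | inj₁ good | c' = contradiction good (crowded⇒¬good _ c')
-- Uniqueness identifies the pair found after the exchange with the original one.
...   | inj₂ (l , l' , c″) | c' with refl , refl ← crowded-unique _ c' c″ =
  𝔇-≡ n (exchange-involutive k k' v)

-- Permutations of height at most one

module GoodStats {v : Vec (Fin m) m} (inj : Inj v) (good : Good v) where

  module _ {h : ℕ} {i j : Fin m} (i<h : toℕ i < h) (j<h : toℕ j < h)
           (h≤σi : h ≤ toℕ (σ v i)) (h≤σj : h ≤ toℕ (σ v j)) where

    -- σ⁻¹ restricted to the values below h, redirecting to i the only one
    -- whose preimage is not below h; if i ≢ j then j is not hit.
    data Redirected (x : Fin m) : Fin m → Set where
      inside  : toℕ x < h → toℕ (σ⁻¹ v x) < h → Redirected x (σ⁻¹ v x)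
      hole    : toℕ x < h → h ≤ toℕ (σ⁻¹ v x) → Redirected x i
      outside : h ≤ toℕ x → Redirected x x

    redirect : ∀ x → ∃ (Redirected x)
    redirect x with toℕ x ℕ.<? h | toℕ (σ⁻¹ v x) ℕ.<? h
    ... | yes p | yes q = _ , inside p q
    ... | yes p | no q  = _ , hole p (ℕ.≮⇒≥ q)
    ... | no p  | _     = _ , outside (ℕ.≮⇒≥ p)

    preimage≢ : ∀ {x y} → toℕ x < h → h ≤ toℕ (σ v y) → σ⁻¹ v x ≢ y
    preimage≢ {x} x<h h≤σy refl =
      ℕ.<⇒≱ x<h (subst (λ z → h ≤ toℕ z) (σ∘σ⁻¹ v inj x) h≤σy)

    σ⁻¹-injective : ∀ {x y} → σ⁻¹ v x ≡ σ⁻¹ v y → x ≡ y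
    σ⁻¹-injective {x} {y} e = trans (sym (σ∘σ⁻¹ v inj x)) (trans (cong (σ v) e) (σ∘σ⁻¹ v inj y))

    redirected-injective : ∀ {x y z z'} → Redirected x z → Redirected y z' → z ≡ z' → x ≡ y
    redirected-injective (inside _ _)  (inside _ _)  e = σ⁻¹-injective e
    redirected-injective (inside p _)  (hole _ _)    e = contradiction e (preimage≢ p h≤σi)
    redirected-injective (inside _ q)  (outside r)   refl = contradiction r (ℕ.<⇒≱ q)
    redirected-injective (hole _ _)    (inside p _)  e = contradiction (sym e) (preimage≢ p h≤σi)
    redirected-injective {x} {y} (hole p q) (hole p' q') e =
      σ⁻¹-injective (good h _ _ q q' (value p) (value p'))
      where
      value : ∀ {z} → toℕ z < h → toℕ (σ v (σ⁻¹ v z)) < h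
      value {z} = subst (λ w → toℕ w < h) (sym (σ∘σ⁻¹ v inj z))
    redirected-injective (hole _ _)    (outside r)   refl = contradiction r (ℕ.<⇒≱ i<h)
    redirected-injective (outside r)   (inside _ q)  refl = contradiction r (ℕ.<⇒≱ q)
    redirected-injective (outside r)   (hole _ _)    refl = contradiction r (ℕ.<⇒≱ i<h)
    redirected-injective (outside _)   (outside _)   e = e

    -- A permutation crosses a level as often upwards as downwards. Being injective, `redirect` is
    -- surjective; it can reach `j` only as the redirected value, which is `i`.
    upper-narrow : i ≡ j
    upper-narrow with x , e ← injective⇒surjective {f = proj₁ ∘ redirect}
                        (λ {x} {y} → redirected-injective (proj₂ (redirect x)) (proj₂ (redirect y))) j
      with redirect x | e
    ... | _ , inside p _ | e' = contradiction e' (preimage≢ p h≤σj)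
    ... | _ , hole _ _   | e' = e'
    ... | _ , outside r  | refl = contradiction r (ℕ.<⇒≱ j<h)

  count-zero : ∀ {p : Fin m → Bool} → (∀ j → ¬ T (p j)) → countB p (allFin m) ≡ 0
  count-zero ¬p = ∑-zero (λ j → cong 𝟙 (¬T⇒≡false (¬p j))) (allFin m)

  sumOver-zero : ∀ P {f : Fin m → ℕ} → (∀ i → f i ≡ 0) → sumOver v P f ≡ 0
  sumOver-zero P {f} f≡0 = ∑-zero go (allFin m)
    where
    go : ∀ i → (if P i then f i else 0) ≡ 0
    go i with P i
    ... | true  = f≡0 i
    ... | false = refl

  lower-nested : ∀ {i j} → i <ᶠ j → σ v i <ᶠ i → σ v j <ᶠ i → ⊥
  lower-nested {i} {j} i<j σi<i σj<i = <⇒≢ i<j (good (toℕ i) i j ℕ.≤-refl (ℕ.<⇒≤ i<j) σi<i σj<i)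

  upper-nested : ∀ {i j} → j <ᶠ i → i <ᶠ σ v i → i <ᶠ σ v j → ⊥
  -- At level `suc i` the position `i` still counts as below, while both values are at or above.
  upper-nested {i} {j} j<i i<σi i<σj = <⇒≢ j<i (upper-narrow {suc (toℕ i)} (ℕ.m<n⇒m<1+n j<i) ℕ.≤-refl i<σj i<σi)

  lnestAt-zero : ∀ i → lnestAt v i ≡ 0
  lnestAt-zero i = count-zero λ j t → let a , b , c = chain⁻ i j (σ v i) i (σ v j) (σ v i) t in
    lower-nested a b (<-trans c b)

  lcrossAt-zero : ∀ i → lcrossAt v i ≡ 0
  lcrossAt-zero i = count-zero λ j t → let a , b , c = chain⁻ i j (σ v j) i (σ v i) (σ v j) t in
    lower-nested a (<-trans c b) b

  ucrossAt-zero : ∀ i → ucrossAt v i ≡ 0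
  ucrossAt-zero i = count-zero λ j t → let a , b , c = chain⁻ j i i (σ v j) (σ v j) (σ v i) t in
    upper-nested a (<-trans b c) b

  unestAt-zero : ∀ i → unestAt v i ≡ 0
  unestAt-zero i = count-zero λ j t → let a , b , c = chain⁻ j i i (σ v i) (σ v i) (σ v j) t in
    upper-nested a b (<-trans b c)

  ≢⇒<⊎> : ∀ {a b : Fin m} → a ≢ b → a <ᶠ b ⊎ b <ᶠ a
  ≢⇒<⊎> {a} {b} a≢b with <-cmp a b
  ... | tri< p _ _ = inj₁ p
  ... | tri≈ _ p _ = contradiction p a≢b
  ... | tri> _ _ p = inj₂ p

  -- A smaller value at a later `j` would give two positions from `i` on with values below `i`.
  lower⇒antirecord : ∀ {i} → σ v i <ᶠ i → T (isAntirecord v i)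
  lower⇒antirecord {i} σi<i = antirecord⁺ v {i} go
    where
    go : ∀ j → i <ᶠ j → σ v i <ᶠ σ v j
    go j i<j with ≢⇒<⊎> (<⇒≢ i<j ∘ inj)
    ... | inj₁ p = p
    ... | inj₂ p = ⊥-elim (lower-nested i<j σi<i (<-trans p σi<i))

  upper⇒record : ∀ {i} → i <ᶠ σ v i → T (isRecord v i)
  upper⇒record {i} i<σi = record⁺ v {i} go
    where
    go : ∀ j → j <ᶠ i → σ v j <ᶠ σ v i
    go j j<i with ≢⇒<⊎> (<⇒≢ j<i ∘ inj)
    ... | inj₁ p = p
    ... | inj₂ p = ⊥-elim (upper-nested j<i i<σi (<-trans i<σi p))

  nr-zero : ∀ {P : Fin m → Bool} → (∀ i → T (P i) → σ v i <ᶠ i ⊎ i <ᶠ σ v i) → nr v P ≡ 0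
  nr-zero {P} side = count-zero go
    where
    go : ∀ i → ¬ T (P i ∧ not (isRecord v i) ∧ not (isAntirecord v i))
    go i t with p , r ← T-∧⁻ {P i} t with a , b ← T-∧⁻ {not (isRecord v i)} r with side i p
    ... | inj₁ q = subst (λ x → T (not x)) (T⇒≡true (lower⇒antirecord q)) b
    ... | inj₂ q = subst (λ x → T (not x)) (T⇒≡true (upper⇒record q)) a

  nrcpeak-zero : nrcpeak v ≡ 0
  nrcpeak-zero = nr-zero λ i t → inj₁ (ℕ.<ᵇ⇒< _ _ (proj₂ (T-∧⁻ {σ⁻¹ v i <F i} t)))

  nrcval-zero : nrcval v ≡ 0
  nrcval-zero = nr-zero λ i t → inj₂ (ℕ.<ᵇ⇒< _ _ (proj₂ (T-∧⁻ {i <F σ⁻¹ v i} t)))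

  nrcdrise-zero : nrcdrise v ≡ 0
  nrcdrise-zero = nr-zero λ i t → inj₂ (ℕ.<ᵇ⇒< _ _ (proj₂ (T-∧⁻ {σ⁻¹ v i <F i} t)))

  nrcdfall-zero : nrcdfall v ≡ 0
  nrcdfall-zero = nr-zero λ i t → inj₁ (ℕ.<ᵇ⇒< _ _ (proj₂ (T-∧⁻ {i <F σ⁻¹ v i} t)))

  stat-good : ∀ s → stat s v ≡ 0
  stat-good s-nrcpeak     = nrcpeak-zero
  stat-good s-nrcval      = nrcval-zero
  stat-good s-nrcAll      =
    cong₂ _+_ (cong₂ _+_ (cong₂ _+_ nrcpeak-zero nrcval-zero) nrcdrise-zero) nrcdfall-zero
  stat-good s-lcrosscpeak = sumOver-zero (isCPeak v) lcrossAt-zero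
  stat-good s-lnestcpeak  = sumOver-zero (isCPeak v) lnestAt-zero
  stat-good s-ucrosscval  = sumOver-zero (isCVal v) ucrossAt-zero
  stat-good s-unestcval   = sumOver-zero (isCVal v) unestAt-zero
  stat-good s-lcross      = sumOver-zero (λ _ → true) lcrossAt-zero
  stat-good s-lnest       = sumOver-zero (λ _ → true) lnestAt-zero
  stat-good s-ucross      = sumOver-zero (λ _ → true) ucrossAt-zero
  stat-good s-unest       = sumOver-zero (λ _ → true) unestAt-zero
  stat-good s-cross       = cong₂ _+_ (stat-good s-ucross) (stat-good s-lcross)
  stat-good s-nest        = cong₂ _+_ (stat-good s-unest) (stat-good s-lnest)

-- Conjugation by i ↦ 2n + 1 − i

opposite-< : ∀ {i j : Fin m} → i <ᶠ j → opposite j <ᶠ opposite i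
opposite-< {m} {i} {j} i<j rewrite opposite-prop i | opposite-prop j =
  ℕ.∸-monoʳ-< (s≤s i<j) (toℕ<n j)

opposite-<F : ∀ (i j : Fin m) → (opposite i <F opposite j) ≡ (j <F i)
opposite-<F i j = T-ext
  (λ t → ℕ.<⇒<ᵇ (subst₂ _<ᶠ_ (opposite-involutive j) (opposite-involutive i) (opposite-< (ℕ.<ᵇ⇒< _ _ t))))
  (λ t → ℕ.<⇒<ᵇ (opposite-< {i = j} {i} (ℕ.<ᵇ⇒< _ _ t)))

∑-opposite : ∀ (f : Fin m → ℕ) → ∑ f (allFin m) ≡ ∑ (f ∘ opposite) (allFin m)
∑-opposite f = ∑-involution f (allFin⁺ _) ∈-allFin opposite opposite-involutive

mirror : Vec (Fin m) m → Vec (Fin m) m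
mirror v = tabulate (opposite ∘ σ v ∘ opposite)

module _ (v : Vec (Fin m) m) where

  σ-mirror : ∀ i → σ (mirror v) (opposite i) ≡ opposite (σ v i)
  σ-mirror i = trans (lookup∘tabulate _ (opposite i)) (cong (opposite ∘ σ v) (opposite-involutive i))

  mirror-involutive : mirror (mirror v) ≡ v
  mirror-involutive = lookup-ext λ i → begin
    σ (mirror (mirror v)) i                 ≡⟨ lookup∘tabulate _ i ⟩
    opposite (σ (mirror v) (opposite i))    ≡⟨ cong opposite (σ-mirror i) ⟩
    opposite (opposite (σ v i))             ≡⟨ opposite-involutive (σ v i) ⟩
    σ v i                                   ∎
    where open ≡-Reasoning

  mirror-inj : Inj v → Inj (mirror v)
  mirror-inj inj {i} {j} e = opposite-injective (inj (opposite-injective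
    (trans (sym (lookup∘tabulate _ i)) (trans e (lookup∘tabulate _ j)))))
    where
    opposite-injective : ∀ {a b : Fin m} → opposite a ≡ opposite b → a ≡ b
    opposite-injective {a} {b} e =
      trans (sym (opposite-involutive a)) (trans (cong opposite e) (opposite-involutive b))

  σ⁻¹-mirror : Inj v → ∀ i → σ⁻¹ (mirror v) (opposite i) ≡ opposite (σ⁻¹ v i)
  σ⁻¹-mirror inj i = σ⁻¹-unique (mirror v) (mirror-inj inj)
    (trans (σ-mirror (σ⁻¹ v i)) (cong opposite (σ∘σ⁻¹ v inj i)))

  -- Reversing positions and values turns upper arcs into lower ones; the sum is then reindexed by
  -- `opposite`.
  ucrossAt-mirror : ∀ i → ucrossAt v i ≡ lcrossAt (mirror v) (opposite i)
  ucrossAt-mirror i = trans (∑-cong (λ j → cong 𝟙 (same j)) (allFin m)) (sym (∑-opposite {m} _))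
    where
    same : ∀ j → ((j <F i) ∧ (i <F σ v j) ∧ (σ v j <F σ v i)) ≡
                 ((opposite i <F opposite j) ∧ (σ (mirror v) (opposite j) <F opposite i) ∧
                  (σ (mirror v) (opposite i) <F σ (mirror v) (opposite j)))
    same j rewrite σ-mirror i | σ-mirror j | opposite-<F i j
                 | opposite-<F (σ v j) i | opposite-<F (σ v i) (σ v j) = refl

  unestAt-mirror : ∀ i → unestAt v i ≡ lnestAt (mirror v) (opposite i)
  unestAt-mirror i = trans (∑-cong (λ j → cong 𝟙 (same j)) (allFin m)) (sym (∑-opposite {m} _))
    where
    same : ∀ j → ((j <F i) ∧ (i <F σ v i) ∧ (σ v i <F σ v j)) ≡
                 ((opposite i <F opposite j) ∧ (σ (mirror v) (opposite i) <F opposite i) ∧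
                  (σ (mirror v) (opposite j) <F σ (mirror v) (opposite i)))
    same j rewrite σ-mirror i | σ-mirror j | opposite-<F i j
                 | opposite-<F (σ v i) i | opposite-<F (σ v j) (σ v i) = refl

  isCVal-mirror : Inj v → ∀ i → isCVal v i ≡ isCPeak (mirror v) (opposite i)
  isCVal-mirror inj i rewrite σ⁻¹-mirror inj i | σ-mirror i
    | opposite-<F (σ⁻¹ v i) i | opposite-<F (σ v i) i = refl

  record⇒antirecord : ∀ i → T (isRecord v i) → T (isAntirecord (mirror v) (opposite i))
  record⇒antirecord i t = antirecord⁺ (mirror v) {opposite i} λ j oi<j →
    subst₂ _<ᶠ_ (sym (σ-mirror i)) (sym (lookup∘tabulate _ j))
      (opposite-< (record⁻ v {i} t (opposite j)
        (subst (opposite j <ᶠ_) (opposite-involutive i) (opposite-< oi<j))))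

  antirecord⇒record : ∀ i → T (isAntirecord v i) → T (isRecord (mirror v) (opposite i))
  antirecord⇒record i t = record⁺ (mirror v) {opposite i} λ j j<oi →
    subst₂ _<ᶠ_ (sym (lookup∘tabulate _ j)) (sym (σ-mirror i))
      (opposite-< (antirecord⁻ v {i} t (opposite j)
        (subst (_<ᶠ opposite j) (opposite-involutive i) (opposite-< j<oi))))

module _ (v : Vec (Fin m) m) where

  -- The converse is the dual implication for `mirror v`, since mirroring twice is the identity.
  isRecord-mirror : ∀ i → isRecord v i ≡ isAntirecord (mirror v) (opposite i)
  isRecord-mirror i = T-ext (record⇒antirecord v i)
    (subst₂ (λ u j → T (isRecord u j)) (mirror-involutive v) (opposite-involutive i)
      ∘ antirecord⇒record (mirror v) (opposite i))

  isAntirecord-mirror : ∀ i → isAntirecord v i ≡ isRecord (mirror v) (opposite i)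
  isAntirecord-mirror i = T-ext (antirecord⇒record v i)
    (subst₂ (λ u j → T (isAntirecord u j)) (mirror-involutive v) (opposite-involutive i)
      ∘ record⇒antirecord (mirror v) (opposite i))

  sumOver-mirror : ∀ {P} P' {f} f' →
                   (∀ i → P i ≡ P' (opposite i)) → (∀ i → f i ≡ f' (opposite i)) →
                   sumOver v P f ≡ sumOver (mirror v) P' f'
  sumOver-mirror P' f' P≡ f≡ = trans
    (∑-cong (λ i → cong₂ (λ b x → if b then x else 0) (P≡ i) (f≡ i)) (allFin m))
    (sym (∑-opposite {m} _))

  nrcval-mirror : Inj v → nrcval v ≡ nrcpeak (mirror v)
  nrcval-mirror inj = trans (∑-cong (λ i → cong 𝟙 (same i)) (allFin m)) (sym (∑-opposite {m} _))
    where
    same : ∀ i → (isCVal v i ∧ not (isRecord v i) ∧ not (isAntirecord v i)) ≡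
                 (isCPeak (mirror v) (opposite i) ∧ not (isRecord (mirror v) (opposite i)) ∧
                  not (isAntirecord (mirror v) (opposite i)))
    same i rewrite isCVal-mirror v inj i | isRecord-mirror i | isAntirecord-mirror i =
      cong (isCPeak (mirror v) (opposite i) ∧_) (∧-comm (not (isAntirecord (mirror v) (opposite i))) _)

data Dual : StatName → StatName → Set where
  d-nrc    : Dual s-nrcval s-nrcpeak
  d-crossc : Dual s-ucrosscval s-lcrosscpeak
  d-nestc  : Dual s-unestcval s-lnestcpeak
  d-cross  : Dual s-ucross s-lcross
  d-nest   : Dual s-unest s-lnest

stat-mirror : ∀ {s s'} → Dual s s' → (v : Vec (Fin m) m) → Inj v → stat s v ≡ stat s' (mirror v)
stat-mirror d-nrc    v inj = nrcval-mirror v inj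
stat-mirror d-crossc v inj =
  sumOver-mirror v (isCPeak (mirror v)) (lcrossAt (mirror v)) (isCVal-mirror v inj) (ucrossAt-mirror v)
stat-mirror d-nestc  v inj =
  sumOver-mirror v (isCPeak (mirror v)) (lnestAt (mirror v)) (isCVal-mirror v inj) (unestAt-mirror v)
stat-mirror d-cross  v inj =
  sumOver-mirror v (λ _ → true) (lcrossAt (mirror v)) (λ _ → refl) (ucrossAt-mirror v)
stat-mirror d-nest   v inj =
  sumOver-mirror v (λ _ → true) (lnestAt (mirror v)) (λ _ → refl) (unestAt-mirror v)

isEvenℕ-+ : ∀ a b → isEvenℕ (a + b) ≡ true → isEvenℕ a ≡ isEvenℕ b
isEvenℕ-+ zero    b e = sym e
isEvenℕ-+ (suc a) b e = trans
  (cong not (isEvenℕ-+ a (suc b) (trans (cong isEvenℕ (ℕ.+-suc a b)) e)))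
  (not-involutive (isEvenℕ b))

isEvenℕ-2* : ∀ n → isEvenℕ (2 * n) ≡ true
isEvenℕ-2* zero    = refl
isEvenℕ-2* (suc n) rewrite ℕ.+-suc n (n + 0) = trans (not-involutive _) (isEvenℕ-2* n)

-- A position and its opposite add up to the odd number 2n - 1. Mirroring reverses inequalities and
-- parities alike, so it preserves the D-condition.
opposite-parity : ∀ n (i : Fin (2 * n)) → isEvenℕ (toℕ (opposite i)) ≡ not (isEvenℕ (toℕ i))
opposite-parity n i = isEvenℕ-+ (toℕ (opposite i)) (suc (toℕ i)) (begin
  isEvenℕ (toℕ (opposite i) + suc (toℕ i))       ≡⟨ cong (λ x → isEvenℕ (x + suc (toℕ i))) (opposite-prop i) ⟩
  isEvenℕ ((2 * n ∸ suc (toℕ i)) + suc (toℕ i))  ≡⟨ cong isEvenℕ (ℕ.m∸n+n≡m (toℕ<n i)) ⟩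
  isEvenℕ (2 * n)                                ≡⟨ isEvenℕ-2* n ⟩
  true                                           ∎)
  where open ≡-Reasoning

isDPerm-mirror : ∀ n (v : Vec (Fin (2 * n)) (2 * n)) → T (isDPerm v) → T (isDPerm (mirror v))
isDPerm-mirror n v t = T-∧⁺ (isPerm⁺ (mirror v) (mirror-inj v (𝔇-injective n (v , t)))) (allB-allFin⁺ λ i →
  subst (λ j → T (cond (mirror v) j)) (opposite-involutive i)
    (subst T (sym (same (opposite i))) (allB-allFin⁻ (proj₂ (T-∧⁻ {isPerm v} t)) (opposite i))))
  where
  cond : Vec (Fin (2 * n)) (2 * n) → Fin (2 * n) → Bool
  cond u i = if isEvenℕ (toℕ i) then not (app u i <F i) else not (i <F app u i)
  same : ∀ i → cond (mirror v) (opposite i) ≡ cond v i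
  same i rewrite opposite-parity n i | σ-mirror v i | opposite-<F (σ v i) i | opposite-<F i (σ v i)
    with isEvenℕ (toℕ i)
  ... | true  = refl
  ... | false = refl

mirror𝔇 : ∀ n → 𝔇 n → 𝔇 n
mirror𝔇 n (v , t) = mirror v , isDPerm-mirror n v t

mirror𝔇-involutive : ∀ n → IsInvolution (mirror𝔇 n)
mirror𝔇-involutive n (v , t) = 𝔇-≡ n (mirror-involutive v)

-- Counting the permutations of height at most one

-- Partial permutations of all lengths share this type, as maps that are the identity from some
-- point on.
Map : Set
Map = ℕ → ℕ

private
  ℕ→ℕ = ℕ →-setoid ℕ

-- Cardinality up to pointwise equality, hence the setoid of functions in `distinct` and `complete`.
record HasSize (P : Map → Set) (k : ℕ) : Set where
  field
    list     : List Map
    size     : length list ≡ k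
    sound    : All P list
    distinct : Setoid.Unique ℕ→ℕ list
    complete : ∀ {π} → P π → Any (π ≗_) list

open HasSize

size-⊎ : ∀ {P Q R : Map → Set} {a b} → (∀ {π} → R π → P π ⊎ Q π) → (∀ {π} → P π → R π) → (∀ {π} → Q π → R π) →
         (∀ {π ρ} → P π → Q ρ → ¬ π ≗ ρ) → HasSize P a → HasSize Q b → HasSize R (a + b)
size-⊎ split fromP fromQ disjoint p q = record
  { list     = list p ++ list q
  ; size     = trans (length-++ (list p)) (cong₂ _+_ (size p) (size q))
  ; sound    = All.++⁺ (All.map fromP (sound p)) (All.map fromQ (sound q))
  ; distinct = Setoid.++⁺ ℕ→ℕ (distinct p) (distinct q) λ (π∈p , π∈q) →
      let pπ , π≗ = All.lookupAny (sound p) π∈p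
          qρ , ρ≗ = All.lookupAny (sound q) π∈q
      in disjoint pπ qρ λ x → trans (sym (π≗ x)) (ρ≗ x)
  ; complete = [ Any.++⁺ˡ ∘ complete p , Any.++⁺ʳ (list p) ∘ complete q ]′ ∘ split
  }

size-map : ∀ {P Q : Map → Set} {a} (f g : Map → Map) →
           (∀ {π ρ} → π ≗ ρ → f π ≗ f ρ) → (∀ {π ρ} → f π ≗ f ρ → π ≗ ρ) → (∀ π → f (g π) ≗ π) →
           (∀ {π} → P π → Q (f π)) → (∀ {π} → Q π → P (g π)) → HasSize P a → HasSize Q a
size-map f g f-cong f-inj fg≗id to from p = record
  { list     = map f (list p)
  ; size     = trans (length-map f (list p)) (size p)
  ; sound    = All.map⁺ (All.map to (sound p))
  ; distinct = Setoid.map⁺ ℕ→ℕ ℕ→ℕ f-inj (distinct p)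
  ; complete = λ {π} qπ → Any.map⁺
      (Any.map (λ e x → trans (sym (fg≗id π x)) (f-cong e x)) (complete p (from qπ)))
  }

size-⇔ : ∀ {P Q : Map → Set} {a} → (∀ {π} → P π → Q π) → (∀ {π} → Q π → P π) → HasSize P a → HasSize Q a
size-⇔ = size-map id id id id (λ _ _ → refl)

-- Completeness of either list gives an injection from the indices of the other into its own.
size-unique : ∀ {P : Map → Set} {a b} → HasSize P a → HasSize P b → a ≡ b
size-unique {P} p q = ℕ.≤-antisym (size-≤ p q) (size-≤ q p)
  where
  lookup-injective : ∀ {πs} → Setoid.Unique ℕ→ℕ πs → ∀ {i j} → List.lookup πs i ≗ List.lookup πs j → i ≡ j
  lookup-injective {_ ∷ _} (_ ∷ _)  {Fin.zero}  {Fin.zero}  e = refl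
  lookup-injective {_ ∷ _} (ne ∷ _) {Fin.zero}  {Fin.suc j} e = contradiction e (All.lookup ne (∈-lookup j))
  lookup-injective {_ ∷ _} (ne ∷ _) {Fin.suc i} {Fin.zero}  e =
    contradiction (λ x → sym (e x)) (All.lookup ne (∈-lookup i))
  lookup-injective {_ ∷ _} (_ ∷ u)  {Fin.suc i} {Fin.suc j} e = cong Fin.suc (lookup-injective u e)

  size-≤ : ∀ {a b} → HasSize P a → HasSize P b → a ≤ b
  size-≤ p q = subst₂ _≤_ (size p) (size q) (injective⇒≤ {f = Any.index ∘ member} λ {i} {j} e →
    lookup-injective (distinct p) (index-injective ℕ→ℕ (member i) (member j) e))
    where
    member : ∀ i → Any (List.lookup (list p) i ≗_) (list q)
    member i = complete q (All.lookup (sound p) (∈-lookup i))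

-- The transposition of m and m + 1

τ : ℕ → Map
τ zero    zero          = 1
τ zero    (suc zero)    = 0
τ zero    (suc (suc x)) = suc (suc x)
τ (suc m) zero          = zero
τ (suc m) (suc x)       = suc (τ m x)

τ-involutive : ∀ m x → τ m (τ m x) ≡ x
τ-involutive zero    zero          = refl
τ-involutive zero    (suc zero)    = refl
τ-involutive zero    (suc (suc x)) = refl
τ-involutive (suc m) zero          = refl
τ-involutive (suc m) (suc x)       = cong suc (τ-involutive m x)

τ-injective : ∀ m {x y} → τ m x ≡ τ m y → x ≡ y
τ-injective m {x} {y} e = trans (sym (τ-involutive m x)) (trans (cong (τ m) e) (τ-involutive m y))

τ-m : ∀ m → τ m m ≡ suc m
τ-m zero    = refl
τ-m (suc m) = cong suc (τ-m m)

τ-1+m : ∀ m → τ m (suc m) ≡ m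
τ-1+m zero    = refl
τ-1+m (suc m) = cong suc (τ-1+m m)

τ-below : ∀ {m x} → x < m → τ m x ≡ x
τ-below {suc m} {zero}  _         = refl
τ-below {suc m} {suc x} (s≤s x<m) = cong suc (τ-below x<m)

τ-above : ∀ {m x} → suc m < x → τ m x ≡ x
τ-above {zero}  {suc (suc x)} _        = refl
τ-above {zero}  {suc zero} (s≤s ())
τ-above {suc m} {suc x}       (s≤s lt) = cong suc (τ-above lt)

-- Both exchanged numbers are at least `h`. So composing with `τ m` on either side preserves
-- narrowness at all levels up to `m`.
τ-≥ : ∀ {h m x} → h ≤ m → h ≤ x → h ≤ τ m x
τ-≥ {zero}  _ _ = z≤n
τ-≥ {suc h} {suc m} {suc x} (s≤s p) (s≤s q) = s≤s (τ-≥ p q)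

-- Positions count from 0, so the even ones here are those that may not go down.
DAt : ℕ → ℕ → Set
DAt i x = (isEvenℕ i ≡ true → i ≤ x) × (isEvenℕ i ≡ false → x ≤ i)

NarrowMap : Map → ℕ → Set
NarrowMap π h = ∀ {i j} → h ≤ i → h ≤ j → π i < h → π j < h → i ≡ j

-- The positions below `m` are treated, and all beyond `M` are fixed. When `M` is `m`, the number
-- `m` is a placeholder for the open ends. `Core m (suc m)` is the intermediate form in which `m`
-- and `suc m` may be exchanged before position `m` is treated.
record Core (m M : ℕ) (π : Map) : Set where
  field
    inj    : ∀ {i j} → π i ≡ π j → i ≡ j
    fix    : ∀ {i} → M < i → π i ≡ i
    dcond  : ∀ {i} → i < m → DAt i (π i)
    narrow : ∀ {h} → h ≤ m → NarrowMap π h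

  bounded : ∀ {i} → i ≤ M → π i ≤ M
  bounded {i} i≤M = ℕ.≮⇒≥ λ M<πi → ℕ.≤⇒≯ i≤M (subst (M <_) (inj (fix M<πi)) M<πi)

  -- Positions after `M` are fixed, so only `M` itself can have a value below such a level.
  narrow-beyond : ∀ {h} → M ≤ h → NarrowMap π h
  narrow-beyond {h} M≤h h≤i h≤j πi<h πj<h = trans (at h≤i πi<h) (sym (at h≤j πj<h))
    where
    at : ∀ {i} → h ≤ i → π i < h → i ≡ M
    at {i} h≤i πi<h with ℕ.m≤n⇒m<n∨m≡n (ℕ.≤-trans M≤h h≤i)
    ... | inj₁ M<i = contradiction h≤i (ℕ.<⇒≱ (subst (_< h) (fix M<i) πi<h))
    ... | inj₂ M≡i = sym M≡i

open Core

module _ {m : ℕ} {π : Map} where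

  core-∘τ : Core m (suc m) π → Core m (suc m) (π ∘ τ m)
  core-∘τ c = record
    { inj    = λ e → τ-injective m (inj c e)
    ; fix    = λ lt → trans (cong π (τ-above lt)) (fix c lt)
    ; dcond  = λ {i} i<m → subst (DAt i) (cong π (sym (τ-below i<m))) (dcond c i<m)
    ; narrow = λ h≤m h≤i h≤j p q → τ-injective m (narrow c h≤m (τ-≥ h≤m h≤i) (τ-≥ h≤m h≤j) p q)
    }

  core-τ∘ : Core m (suc m) π → Core m (suc m) (τ m ∘ π)
  core-τ∘ c = record
    { inj    = λ e → inj c (τ-injective m e)
    ; fix    = λ lt → trans (cong (τ m) (fix c lt)) (τ-above lt)
    ; dcond  = λ {i} i<m → (λ even → τ-≥ (ℕ.<⇒≤ i<m) (proj₁ (dcond c i<m) even))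
                         , (λ odd → let πi≤i = proj₂ (dcond c i<m) odd in
                              subst (_≤ i) (sym (τ-below (ℕ.≤-<-trans πi≤i i<m))) πi≤i)
    ; narrow = λ h≤m h≤i h≤j p q → narrow c h≤m h≤i h≤j (below h≤m p) (below h≤m q)
    }
    where
    below : ∀ {h x} → h ≤ m → τ m x < h → x < h
    below h≤m lt = ℕ.≰⇒> λ h≤x → ℕ.<⇒≱ lt (τ-≥ h≤m h≤x)

  core-weaken : Core m m π → Core m (suc m) π
  core-weaken c = record
    { inj = inj c ; fix = λ lt → fix c (ℕ.<-trans (ℕ.n<1+n m) lt) ; dcond = dcond c ; narrow = narrow c }

  core-shrink : Core m (suc m) π → π (suc m) ≡ suc m → Core m m π
  core-shrink c e = record { inj = inj c ; fix = fix' ; dcond = dcond c ; narrow = narrow c }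
    where
    fix' : ∀ {i} → m < i → π i ≡ i
    fix' m<i with ℕ.m≤n⇒m<n∨m≡n m<i
    ... | inj₁ lt     = fix c lt
    ... | inj₂ refl = e

  -- The one new height condition, at level `suc m`, is automatic by `narrow-beyond`.
  core-grow : Core m (suc m) π → DAt m (π m) → Core (suc m) (suc m) π
  core-grow c d = record { inj = inj c ; fix = fix c ; dcond = dcond' ; narrow = narrow' }
    where
    dcond' : ∀ {i} → i < suc m → DAt i (π i)
    dcond' (s≤s i≤m) with ℕ.m≤n⇒m<n∨m≡n i≤m
    ... | inj₁ lt     = dcond c lt
    ... | inj₂ refl = d
    narrow' : ∀ {h} → h ≤ suc m → NarrowMap π h
    narrow' h≤1+m with ℕ.m≤n⇒m<n∨m≡n h≤1+m
    ... | inj₁ (s≤s h≤m) = narrow c h≤m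
    ... | inj₂ refl    = narrow-beyond c ℕ.≤-refl

  core-ungrow : Core (suc m) (suc m) π → Core m (suc m) π × DAt m (π m)
  core-ungrow c = record { inj = inj c ; fix = fix c ; dcond = dcond c ∘ ℕ.m<n⇒m<1+n
                         ; narrow = narrow c ∘ ℕ.m≤n⇒m≤1+n }
                , dcond c ℕ.≤-refl

-- A closed map has treated 0,…,m-1 with no arc left open.  An open map has one
-- open upper arc p → · and one open lower arc · → v, recorded as p → m → v.
Closed Open Stage : ℕ → Map → Set
Stage m π = Core m m π
Closed m π = Stage m π × π m ≡ m
Open m π = Stage m π × π m ≢ m

Open-fixed Open-moved : ℕ → Map → Set
Open-fixed m π = Open (suc m) π × π m ≡ m
Open-moved m π = Open (suc m) π × π m ≢ m

Stage-size : ∀ {m a b} → HasSize (Closed m) a → HasSize (Open m) b → HasSize (Stage m) (a + b)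
Stage-size {m} = size-⊎ split proj₁ proj₁ λ (_ , e) (_ , ne) π≗ρ → ne (trans (sym (π≗ρ m)) e)
  where
  split : ∀ {π} → Stage m π → Closed m π ⊎ Open m π
  split {π} g with π m ℕ.≟ m
  ... | yes e = inj₁ (g , e)
  ... | no ne = inj₂ (g , ne)

Open-suc-size : ∀ {m a b} → HasSize (Open-moved m) a → HasSize (Open-fixed m) b → HasSize (Open (suc m)) (a + b)
Open-suc-size {m} = size-⊎ split proj₁ proj₁ λ (_ , ne) (_ , e) π≗ρ → ne (trans (π≗ρ m) e)
  where
  split : ∀ {π} → Open (suc m) π → Open-moved m π ⊎ Open-fixed m π
  split {π} b with π m ℕ.≟ m
  ... | yes e = inj₂ (b , e)
  ... | no ne = inj₁ (b , ne)

DAt-fixed : ∀ {i x} → x ≡ i → DAt i x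
DAt-fixed e = (λ _ → ℕ.≤-reflexive (sym e)) , (λ _ → ℕ.≤-reflexive e)

DAt-even : ∀ {i x} → isEvenℕ i ≡ true → i ≤ x → DAt i x
DAt-even even p = (λ _ → p) , λ odd → contradiction (trans (sym even) odd) λ ()

DAt-odd : ∀ {i x} → isEvenℕ i ≡ false → x ≤ i → DAt i x
DAt-odd odd p = (λ even → contradiction (trans (sym odd) even) λ ()) , λ _ → p

Open-below : ∀ {m π} → Open m π → π m < m
Open-below (g , ne) = ℕ.≤∧≢⇒< (bounded g ℕ.≤-refl) ne

-- Conjugation by `τ m` moves the placeholder to `suc m` and leaves `m` as a new fixed point under
-- the open arcs.
Open-fixed-size : ∀ {m b} → HasSize (Open m) b → HasSize (Open-fixed m) b
Open-fixed-size {m} = size-map conj conj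
  (λ e x → cong (τ m) (e (τ m x)))
  (λ {π} {ρ} e x → subst (λ y → π y ≡ ρ y) (τ-involutive m x) (τ-injective m (e (τ m x))))
  (λ π x → trans (τ-involutive m _) (cong π (τ-involutive m x)))
  to from
  where
  conj : Map → Map
  conj π = τ m ∘ π ∘ τ m
  to : ∀ {π} → Open m π → Open-fixed m (conj π)
  to {π} b@(g , _) = (core-grow (core-τ∘ (core-∘τ (core-weaken g))) (DAt-fixed at-m) , λ e →
      ℕ.<⇒≢ (ℕ.m<n⇒m<1+n (Open-below b)) (trans (sym at-1+m) e)) , at-m
    where
    at-m : conj π m ≡ m
    at-m = trans (cong (τ m ∘ π) (τ-m m)) (trans (cong (τ m) (fix g ℕ.≤-refl)) (τ-1+m m))
    at-1+m : conj π (suc m) ≡ π m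
    at-1+m = trans (cong (τ m ∘ π) (τ-1+m m)) (τ-below (Open-below b))
  from : ∀ {π} → Open-fixed m π → Open m (conj π)
  from {π} (b@(g , _) , πm≡m) =
      core-shrink (core-τ∘ (core-∘τ c)) (trans (cong (τ m ∘ π) (τ-1+m m)) (trans (cong (τ m) πm≡m) (τ-m m)))
    , λ e → ℕ.<⇒≢ below (trans (sym at-m) e)
    where
    c = proj₁ (core-ungrow g)
    below : π (suc m) < m
    below = ℕ.≤∧≢⇒< (s≤s⁻¹ (Open-below b)) λ e → ℕ.1+n≢n (inj g (trans e (sym πm≡m)))
    at-m : conj π m ≡ π (suc m)
    at-m = trans (cong (τ m ∘ π) (τ-m m)) (τ-below below)

-- The D-condition forces `m` to map to `suc m`, so `m` starts the open upper arc. It is a cycle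
-- valley if the previous stage was closed and a double rise if it was open.
Open-moved-size-even : ∀ {m k} → isEvenℕ m ≡ true → HasSize (Stage m) k → HasSize (Open-moved m) k
Open-moved-size-even {m} even = size-map (_∘ τ m) (_∘ τ m)
  (λ e x → e (τ m x))
  (λ {π} {ρ} e x → subst (λ y → π y ≡ ρ y) (τ-involutive m x) (e (τ m x)))
  (λ π x → cong π (τ-involutive m x))
  to from
  where
  to : ∀ {π} → Stage m π → Open-moved m (π ∘ τ m)
  to {π} g = (core-grow (core-∘τ (core-weaken g))
               (DAt-even even (ℕ.≤-trans (ℕ.n≤1+n m) (ℕ.≤-reflexive (sym at-m))))
             , λ e → ℕ.<⇒≢ (s≤s (bounded g ℕ.≤-refl)) (trans (cong π (sym (τ-1+m m))) e))
           , λ e → ℕ.1+n≢n (trans (sym at-m) e)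
    where
    at-m : π (τ m m) ≡ suc m
    at-m = trans (cong π (τ-m m)) (fix g ℕ.≤-refl)
  from : ∀ {π} → Open-moved m π → Stage m (π ∘ τ m)
  from {π} ((g , _) , ne) = core-shrink (core-∘τ c) (trans (cong π (τ-1+m m)) πm≡1+m)
    where
    c = proj₁ (core-ungrow g)
    πm≡1+m : π m ≡ suc m
    πm≡1+m = ℕ.≤-antisym (bounded g (ℕ.n≤1+n m)) (ℕ.≤∧≢⇒< (proj₁ (proj₂ (core-ungrow g)) even) (ne ∘ sym))

-- The D-condition sends `m` below itself, and narrowness at level `m` then forces `suc m` to map to
-- `m`. So `m` is a double fall inserted into the open lower arc.
Open-moved-size-odd : ∀ {m k} → isEvenℕ m ≡ false → HasSize (Open m) k → HasSize (Open-moved m) k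
Open-moved-size-odd {m} odd = size-map (τ m ∘_) (τ m ∘_)
  (λ e x → cong (τ m) (e x))
  (λ e x → τ-injective m (e x))
  (λ π x → τ-involutive m (π x))
  to from
  where
  to : ∀ {π} → Open m π → Open-moved m (τ m ∘ π)
  to {π} b@(g , ne) =
      (core-grow (core-τ∘ (core-weaken g)) (DAt-odd odd (ℕ.≤-trans (ℕ.≤-reflexive at-m) (ℕ.<⇒≤ (Open-below b))))
      , λ e → ℕ.1+n≢n (trans (sym e) (trans (cong (τ m) (fix g ℕ.≤-refl)) (τ-1+m m))))
    , λ e → ne (trans (sym at-m) e)
    where
    at-m : τ m (π m) ≡ π m
    at-m = τ-below (Open-below b)
  from : ∀ {π} → Open-moved m π → Open m (τ m ∘ π)
  from {π} (b@(g , _) , ne) =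
      core-shrink (core-τ∘ c) (trans (cong (τ m) π1+m≡m) (τ-m m))
    , λ e → ne (trans (sym (τ-below πm<m)) e)
    where
    c = proj₁ (core-ungrow g)
    πm<m : π m < m
    πm<m = ℕ.≤∧≢⇒< (proj₂ (proj₂ (core-ungrow g)) odd) ne
    π1+m≡m : π (suc m) ≡ m
    π1+m≡m = ℕ.≤-antisym (s≤s⁻¹ (Open-below b)) (ℕ.≮⇒≥ λ lt →
      ℕ.1+n≢n (sym (narrow c ℕ.≤-refl ℕ.≤-refl (ℕ.n≤1+n m) πm<m lt)))

-- Here `m` may not go down, and in a closed result it has nothing above to go to, so it is fixed.
Closed-suc-size-even : ∀ {m k} → isEvenℕ m ≡ true → HasSize (Closed m) k → HasSize (Closed (suc m)) k
Closed-suc-size-even {m} even = size-⇔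
  (λ (g , e) → core-grow (core-weaken g) (DAt-fixed e) , fix g ℕ.≤-refl)
  (λ (g , e) → let c , d = core-ungrow g ; g' = core-shrink c e in
     g' , ℕ.≤-antisym (bounded g' ℕ.≤-refl) (proj₁ d even))

-- In every stage `m` maps to at most `m`, as required: it becomes a fixed point if the stage was
-- closed, and a cycle peak joining the two open arcs otherwise.
Closed-suc-size-odd : ∀ {m k} → isEvenℕ m ≡ false → HasSize (Stage m) k → HasSize (Closed (suc m)) k
Closed-suc-size-odd {m} odd = size-⇔
  (λ g → core-grow (core-weaken g) (DAt-odd odd (bounded g ℕ.≤-refl)) , fix g ℕ.≤-refl)
  (λ (g , e) → core-shrink (proj₁ (core-ungrow g)) e)

Closed-size-zero : HasSize (Closed 0) 1
Closed-size-zero = record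
  { list     = id ∷ []
  ; size     = refl
  ; sound    = (record { inj = id ; fix = λ _ → refl ; dcond = λ () ; narrow = λ { z≤n _ _ () } } , refl) ∷ []
  ; distinct = [] ∷ []
  ; complete = λ (g , e) → here λ { zero → e ; (suc x) → fix g (s≤s z≤n) }
  }

Open-size-zero : HasSize (Open 0) 0
Open-size-zero = record
  { list     = []
  ; size     = refl
  ; sound    = []
  ; distinct = []
  ; complete = λ b → contradiction (Open-below b) λ ()
  }

-- The differences of consecutive `F2n-1`, that is, the Fibonacci numbers 0, 1, 3, 8, ... of even
-- index. They count the open maps up to the factor `2 ^ n`.
ΔF : ℕ → ℕ
ΔF zero    = 0
ΔF (suc n) = F2n-1 n + 2 * ΔF n

F-suc : ∀ n → F2n-1 (suc n) ≡ F2n-1 n + ΔF n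
F-suc zero    = refl
F-suc (suc n) = begin
  3 * F2n-1 (suc n) ∸ F2n-1 n          ≡⟨ cong (λ x → 3 * x ∸ F2n-1 n) (F-suc n) ⟩
  -- Splitting off `F` as the last summand makes the truncated subtraction exact.
  3 * (F + D) ∸ F                      ≡⟨ cong (_∸ F) (lemma F D) ⟩
  ((F + D) + (F + 2 * D)) + F ∸ F      ≡⟨ ℕ.m+n∸n≡m _ F ⟩
  (F + D) + (F + 2 * D)                ≡⟨ cong (_+ (F + 2 * D)) (F-suc n) ⟨
  F2n-1 (suc n) + (F + 2 * D)          ∎
  where
  open ≡-Reasoning
  F = F2n-1 n
  D = ΔF n
  lemma : ∀ f d → 3 * (f + d) ≡ ((f + d) + (f + 2 * d)) + f
  lemma = solve-∀

closed-open-size : ∀ n → HasSize (Closed (2 * n)) (2 ^ n * F2n-1 n) × HasSize (Open (2 * n)) (2 ^ n * ΔF n)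
closed-open-size zero    = Closed-size-zero , Open-size-zero
closed-open-size (suc n) with a , b ← closed-open-size n =
  subst (λ k → HasSize (Closed k) (2 ^ suc n * F2n-1 (suc n)) × HasSize (Open k) (2 ^ suc n * ΔF (suc n)))
    (sym (cong suc (ℕ.+-suc n (n + 0))))
    ( subst (HasSize (Closed _))
        (trans (a-lemma (2 ^ n) (F2n-1 n) (ΔF n)) (cong (2 ^ suc n *_) (sym (F-suc n)))) a″
    , subst (HasSize (Open _)) (b-lemma (2 ^ n) (F2n-1 n) (ΔF n)) b″ )
  where
  even = isEvenℕ-2* n
  odd = cong not even
  -- From counts a and b, the even position yields a and a + 2b, and the odd one then 2a + 2b and 2a
  -- + 4b.
  a' = Closed-suc-size-even even a
  b' = Open-suc-size (Open-moved-size-even even (Stage-size a b)) (Open-fixed-size b)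
  a″ = Closed-suc-size-odd odd (Stage-size a' b')
  b″ = Open-suc-size (Open-moved-size-odd odd b') (Open-fixed-size b')
  a-lemma : ∀ t f d → t * f + ((t * f + t * d) + t * d) ≡ 2 * t * (f + d)
  a-lemma = solve-∀
  b-lemma : ∀ t f d → ((t * f + t * d) + t * d) + ((t * f + t * d) + t * d) ≡ 2 * t * (f + 2 * d)
  b-lemma = solve-∀

-- The enumeration of 𝔇 n

concatMap-map : ∀ {A B C : Set} (f : A → B → C) xs ys →
                concatMap (λ x → map (f x) ys) xs ≡ cartesianProductWith f xs ys
concatMap-map f []       ys = refl
concatMap-map f (x ∷ xs) ys = cong (map (f x) ys ++_) (concatMap-map f xs ys)

allVecs-unique : ∀ m k → Unique (allVecs m k)
allVecs-unique m zero    = [] ∷ []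
allVecs-unique m (suc k) = subst Unique (sym (concatMap-map _∷_ (allFin m) (allVecs m k)))
  (cartesianProductWith⁺ _∷_ ∷-injective (allFin⁺ m) (allVecs-unique m k))

allVecs-complete : ∀ {m k} (v : Vec (Fin m) k) → v ∈ allVecs m k
allVecs-complete []      = here refl
allVecs-complete {m} {suc k} (x ∷ v) = subst (x ∷ v ∈_) (sym (concatMap-map _∷_ (allFin m) (allVecs m k)))
  (∈-cartesianProductWith⁺ _∷_ (∈-allFin x) (allVecs-complete v))

keepD-unique : ∀ n {vs} → Unique vs → Unique (keepD n vs)
keepD-unique n {[]}     []       = []
keepD-unique n {v ∷ vs} (v∉ ∷ u) with T? (isDPerm v)
... | yes p = fresh v∉ ∷ keepD-unique n u
  where
  fresh : ∀ {ws} → All (v ≢_) ws → All ((v , p) ≢_) (keepD n ws)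
  fresh {[]}     []         = []
  fresh {w ∷ ws} (v≢w ∷ ps) with T? (isDPerm w)
  ... | yes _ = (v≢w ∘ cong proj₁) ∷ fresh ps
  ... | no _  = fresh ps
... | no _  = keepD-unique n u

keepD-complete : ∀ n {vs} (d : 𝔇 n) → proj₁ d ∈ vs → d ∈ keepD n vs
keepD-complete n {v ∷ vs} d@(_ , t) d∈ with T? (isDPerm v) | d∈
... | yes _ | here refl = here (𝔇-≡ n refl)
... | yes _ | there d∈vs  = there (keepD-complete n d d∈vs)
... | no ¬p | here refl = contradiction t ¬p
... | no _  | there d∈vs  = keepD-complete n d d∈vs

enum𝔇-unique : ∀ n → Unique (enum𝔇 n)
enum𝔇-unique n = keepD-unique n (allVecs-unique (2 * n) (2 * n))

enum𝔇-complete : ∀ n (d : 𝔇 n) → d ∈ enum𝔇 n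
enum𝔇-complete n d = keepD-complete n d (allVecs-complete (proj₁ d))

-- Decided by `good-or-crowded` itself, so that one case distinction evaluates both this test and
-- `toggle`.
good? : (v : Vec (Fin m) m) → Dec (Good v)
good? v with good-or-crowded v
... | inj₁ good        = yes good
... | inj₂ (_ , _ , c) = no (crowded⇒¬good v c)

-- Good D-permutations as closed maps

extend : Vec (Fin m) m → Map
extend {m} v x with x ℕ.<? m
... | yes x<m = toℕ (σ v (fromℕ< x<m))
... | no _    = x

module _ (v : Vec (Fin m) m) where

  extend-inside : ∀ i → extend v (toℕ i) ≡ toℕ (σ v i)
  extend-inside i with toℕ i ℕ.<? m
  ... | yes p = cong (toℕ ∘ σ v) (fromℕ<-toℕ i p)
  ... | no ¬p = contradiction (toℕ<n i) ¬p

  extend-outside : ∀ {x} → m ≤ x → extend v x ≡ x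
  extend-outside {x} m≤x with x ℕ.<? m
  ... | yes x<m = contradiction m≤x (ℕ.<⇒≱ x<m)
  ... | no _    = refl

data Inside? (m : ℕ) : ℕ → Set where
  inside  : (i : Fin m) → Inside? m (toℕ i)
  outside : ∀ {x} → m ≤ x → Inside? m x

inside? : ∀ m x → Inside? m x
inside? m x with x ℕ.<? m
... | yes p = subst (Inside? m) (toℕ-fromℕ< p) (inside (fromℕ< p))
... | no ¬p = outside (ℕ.≮⇒≥ ¬p)

extend-injective : ∀ {u v : Vec (Fin m) m} → extend u ≗ extend v → u ≡ v
extend-injective {u = u} {v} e = lookup-ext λ i →
  toℕ-injective (trans (sym (extend-inside u i)) (trans (e (toℕ i)) (extend-inside v i)))

isDCond⇒DAt : ∀ (v : Vec (Fin m) m) → T (isDCond v) → ∀ i → DAt (toℕ i) (toℕ (σ v i))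
isDCond⇒DAt v t i with isEvenℕ (toℕ i) | allB-allFin⁻ t i
... | true  | s = (λ _ → ℕ.≮⇒≥ λ lt → subst (T ∘ not) (<ᵇ-true lt) s) , λ ()
... | false | s = (λ ()) , λ _ → ℕ.≮⇒≥ λ lt → subst (T ∘ not) (<ᵇ-true lt) s

DAt⇒isDCond : ∀ (v : Vec (Fin m) m) → (∀ i → DAt (toℕ i) (toℕ (σ v i))) → T (isDCond v)
DAt⇒isDCond {m} v d = allB-allFin⁺ cond
  where
  cond : ∀ i → T (if isEvenℕ (toℕ i) then not (σ v i <F i) else not (i <F σ v i))
  cond i with isEvenℕ (toℕ i) | d i
  ... | true  | p , _ = subst (T ∘ not) (sym (<ᵇ-false (ℕ.≤⇒≯ (p refl)))) _
  ... | false | _ , p = subst (T ∘ not) (sym (<ᵇ-false (ℕ.≤⇒≯ (p refl)))) _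

extend-closed : ∀ (v : Vec (Fin m) m) → T (isDPerm v) → Good v → Closed m (extend v)
extend-closed {m} v t good = record
  { inj = injective ; fix = extend-outside v ∘ ℕ.<⇒≤ ; dcond = v-dcond ; narrow = λ _ → v-narrow }
  , extend-outside v ℕ.≤-refl
  where
  v-injective : Inj v
  v-injective = isPerm⁻ v (proj₁ (T-∧⁻ {isPerm v} t))

  injective : ∀ {i j} → extend v i ≡ extend v j → i ≡ j
  injective {i} {j} e with inside? m i | inside? m j
  ... | inside a  | inside b =
        cong toℕ (v-injective (toℕ-injective (trans (sym (extend-inside v a)) (trans e (extend-inside v b)))))
  ... | inside a  | outside p = contradiction (toℕ<n (σ v a))
        (ℕ.≤⇒≯ (subst (m ≤_) (trans (sym (extend-outside v p)) (trans (sym e) (extend-inside v a))) p))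
  ... | outside p | inside b = contradiction (toℕ<n (σ v b))
        (ℕ.≤⇒≯ (subst (m ≤_) (trans (sym (extend-outside v p)) (trans e (extend-inside v b))) p))
  ... | outside p | outside q = trans (sym (extend-outside v p)) (trans e (extend-outside v q))

  v-dcond : ∀ {i} → i < m → DAt i (extend v i)
  v-dcond {i} i<m with inside? m i
  ... | inside a  = subst (DAt (toℕ a)) (sym (extend-inside v a)) (isDCond⇒DAt v (proj₂ (T-∧⁻ {isPerm v} t)) a)
  ... | outside p = contradiction p (ℕ.<⇒≱ i<m)

  v-narrow : ∀ {h} → NarrowMap (extend v) h
  v-narrow {h} {i} {j} h≤i h≤j p q with inside? m i | inside? m j
  ... | outside o | _ = contradiction (subst (_< h) (extend-outside v o) p) (ℕ.≤⇒≯ h≤i)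
  ... | inside _  | outside o = contradiction (subst (_< h) (extend-outside v o) q) (ℕ.≤⇒≯ h≤j)
  ... | inside a  | inside b = cong toℕ (good h a b h≤i h≤j
        (subst (_< h) (extend-inside v a) p) (subst (_< h) (extend-inside v b) q))

-- A closed map fixes `m`, so no smaller position takes the value `m`, and the map restricts to
-- `Fin m`.
restrict : ∀ {π} → Closed m π → ∃ λ (v : Vec (Fin m) m) → T (isDPerm v) × Good v × π ≗ extend v
restrict {m} {π} (g , πm≡m) = v , T-∧⁺ (isPerm⁺ v v-injective) (DAt⇒isDCond v v-dcond) , good , agree
  where
  bound : ∀ (i : Fin m) → π (toℕ i) < m
  bound i = ℕ.≤∧≢⇒< (Core.bounded g (ℕ.<⇒≤ (toℕ<n i)))
    λ e → ℕ.<⇒≢ (toℕ<n i) (Core.inj g (trans e (sym πm≡m)))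
  v : Vec (Fin m) m
  v = tabulate λ i → fromℕ< (bound i)
  value : ∀ i → toℕ (σ v i) ≡ π (toℕ i)
  value i = trans (cong toℕ (lookup∘tabulate _ i)) (toℕ-fromℕ< (bound i))
  v-injective : Inj v
  v-injective {i} {j} e = toℕ-injective (Core.inj g (trans (sym (value i)) (trans (cong toℕ e) (value j))))
  v-dcond : ∀ i → DAt (toℕ i) (toℕ (σ v i))
  v-dcond i = subst (DAt (toℕ i)) (sym (value i)) (Core.dcond g (toℕ<n i))
  good : Good v
  -- `Core` gives narrowness only up to level `m`; here `h` is at most the position `i`, which is
  -- below `m`.
  good h i j h≤i h≤j p q = toℕ-injective (Core.narrow g (ℕ.≤-trans h≤i (ℕ.<⇒≤ (toℕ<n i))) h≤i h≤j
    (subst (_< h) (value i) p) (subst (_< h) (value j) q))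
  agree : π ≗ extend v
  agree x with inside? m x
  ... | inside i  = sym (trans (extend-inside v i) (value i))
  ... | outside p = trans (π-outside p) (sym (extend-outside v p))
    where
    π-outside : ∀ {x} → m ≤ x → π x ≡ x
    π-outside m≤x with ℕ.m≤n⇒m<n∨m≡n m≤x
    ... | inj₁ m<x    = Core.fix g m<x
    ... | inj₂ refl = πm≡m

goods : ∀ n → List (𝔇 n)
goods n = filter (good? ∘ proj₁) (enum𝔇 n)

goods-size : ∀ n → HasSize (Closed (2 * n)) (length (goods n))
goods-size n = record
  { list     = map (extend ∘ proj₁) (goods n)
  ; size     = length-map _ (goods n)
  ; sound    = All.map⁺ (All.map (λ {d} good → extend-closed (proj₁ d) (proj₂ d) good)
                 (All.all-filter (good? ∘ proj₁) (enum𝔇 n)))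
  ; distinct = Setoid.map⁺ (setoid (𝔇 n)) (ℕ →-setoid ℕ) (λ e → 𝔇-≡ n (extend-injective e))
                 (filter⁺ (good? ∘ proj₁) (enum𝔇-unique n))
  ; complete = λ a → let v , t , good , agree = restrict a in
      Any.map⁺ (Any.map (λ { refl → agree }) (∈-filter⁺ (good? ∘ proj₁) (enum𝔇-complete n (v , t)) good))
  }

-- The closed maps are counted twice, through the good D-permutations and through the recursion.
length-goods : ∀ n → length (goods n) ≡ 2 ^ n * F2n-1 n
length-goods n = size-unique (goods-size n) (proj₁ (closed-open-size n))

-- Evaluation at −1

module ∑ℤ = Sum ℤ.+-0-commutativeMonoid

sign : ℕ → ℤ
sign k = -1ℤ ℤ.^ k

sign-adjacent : ∀ {a b} → Adjacent a b → sign b ≡ ℤ.- sign a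
sign-adjacent {b = b} (inj₁ refl) = sym (trans (cong ℤ.-_ (ℤ.-1*i≡-i (sign b))) (ℤ.neg-involutive (sign b)))
sign-adjacent {a} (inj₂ refl) = ℤ.-1*i≡-i (sign a)

sumℤ-+ : ∀ {A : Set} (f g h : A → ℤ) → (∀ x → f x ≡ g x ℤ.+ h x) → ∀ xs → sumℤ f xs ≡ sumℤ g xs ℤ.+ sumℤ h xs
sumℤ-+ f g h e []       = refl
sumℤ-+ f g h e (x ∷ xs) = begin
  f x ℤ.+ sumℤ f xs                                    ≡⟨ cong₂ ℤ._+_ (e x) (sumℤ-+ f g h e xs) ⟩
  (g x ℤ.+ h x) ℤ.+ (sumℤ g xs ℤ.+ sumℤ h xs)          ≡⟨ interchange (g x) (h x) _ _ ⟩
  (g x ℤ.+ sumℤ g xs) ℤ.+ (h x ℤ.+ sumℤ h xs)          ∎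
  where
  open ≡-Reasoning
  open import Algebra.Properties.CommutativeSemigroup ℤ.+-commutativeSemigroup using (interchange)

sumℤ-neg : ∀ {A : Set} (f : A → ℤ) xs → sumℤ (ℤ.-_ ∘ f) xs ≡ ℤ.- sumℤ f xs
sumℤ-neg f []       = refl
sumℤ-neg f (x ∷ xs) = trans (cong (ℤ._+_ (ℤ.- f x)) (sumℤ-neg f xs)) (sym (ℤ.neg-distrib-+ (f x) _))

i≡-i⇒i≡0 : ∀ i → i ≡ ℤ.- i → i ≡ 0ℤ
i≡-i⇒i≡0 (ℤ.+ zero) _ = refl

sumℤ-indicator : ∀ {A : Set} {P : A → Set} (P? : ∀ x → Dec (P x)) xs →
                 sumℤ (λ x → if does (P? x) then 1ℤ else 0ℤ) xs ≡ ℤ.+ length (filter P? xs)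
sumℤ-indicator P? []       = refl
sumℤ-indicator P? (x ∷ xs) with does (P? x)
... | true  = cong (ℤ._+_ 1ℤ) (sumℤ-indicator P? xs)
... | false = trans (ℤ.+-identityˡ _) (sumℤ-indicator P? xs)

module _ {s : StatName} (lower : Lower s) (n : ℕ) where

  weight good-part bad-part : 𝔇 n → ℤ
  weight (v , _) = sign (stat s v)
  good-part (v , _) = if does (good? v) then 1ℤ else 0ℤ
  bad-part d@(v , _) = if does (good? v) then 0ℤ else weight d

  weight-split : ∀ d → weight d ≡ good-part d ℤ.+ bad-part d
  weight-split d@(v , t) with good? v
  ... | yes good = cong sign (GoodStats.stat-good (𝔇-injective n d) good s)
  ... | no _     = sym (ℤ.+-identityˡ _)

  -- A good permutation is fixed and has bad part 0; a crowded one stays crowded and changes its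
  -- sign.
  bad-part-toggle : ∀ d → bad-part (toggle n d) ≡ ℤ.- bad-part d
  bad-part-toggle d@(v , t) with good-or-crowded v in eq
  ... | inj₁ _ rewrite eq = refl
  ... | inj₂ (k , k' , c) with good-or-crowded (exchange k k' v)
  ...   | inj₁ good = contradiction good
            (crowded⇒¬good _ (crowded-exchange (crowded⇒swap (𝔇-injective n d) c) c))
  ...   | inj₂ _    = sign-adjacent (stat-swap lower (crowded⇒swap (𝔇-injective n d) c))

  -- Reindexing by `toggle` shows that the sum equals its own negative.
  bad-sum : sumℤ bad-part (enum𝔇 n) ≡ 0ℤ
  bad-sum = i≡-i⇒i≡0 _ (begin
    sumℤ bad-part (enum𝔇 n)
      ≡⟨ ∑ℤ.∑-involution bad-part (enum𝔇-unique n) (enum𝔇-complete n) (toggle n) (toggle-involutive n) ⟩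
    sumℤ (bad-part ∘ toggle n) (enum𝔇 n)   ≡⟨ ∑ℤ.∑-cong bad-part-toggle (enum𝔇 n) ⟩
    sumℤ (ℤ.-_ ∘ bad-part) (enum𝔇 n)       ≡⟨ sumℤ-neg bad-part (enum𝔇 n) ⟩
    ℤ.- sumℤ bad-part (enum𝔇 n)            ∎)
    where open ≡-Reasoning

  genPoly-lower : genPoly n (stat s) -1ℤ ≡ ℤ.+ (2 ^ n * F2n-1 n)
  genPoly-lower = begin
    sumℤ weight (enum𝔇 n)
      ≡⟨ sumℤ-+ weight good-part bad-part weight-split (enum𝔇 n) ⟩
    sumℤ good-part (enum𝔇 n) ℤ.+ sumℤ bad-part (enum𝔇 n)
      ≡⟨ cong₂ ℤ._+_ (sumℤ-indicator (good? ∘ proj₁) (enum𝔇 n)) bad-sum ⟩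
    ℤ.+ (length (goods n)) ℤ.+ 0ℤ
      ≡⟨ ℤ.+-identityʳ _ ⟩
    ℤ.+ length (goods n)
      ≡⟨ cong ℤ.+_ (length-goods n) ⟩
    ℤ.+ (2 ^ n * F2n-1 n)                                        ∎
    where open ≡-Reasoning

genPoly-dual : ∀ {s s'} → Dual s s' → ∀ n q → genPoly n (stat s) q ≡ genPoly n (stat s') q
genPoly-dual {s} {s'} dual n q = trans
  (∑ℤ.∑-cong (λ d → cong (q ℤ.^_) (stat-mirror dual (proj₁ d) (𝔇-injective n d))) (enum𝔇 n))
  (sym (∑ℤ.∑-involution (λ d → q ℤ.^ stat s' (proj₁ d)) (enum𝔇-unique n) (enum𝔇-complete n)
    (mirror𝔇 n) (mirror𝔇-involutive n)))

genPoly-at-1 : ∀ n (st : Vec (Fin (2 * n)) (2 * n) → ℕ) → genPoly n st 1ℤ ≡ ℤ.+ length (enum𝔇 n)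
genPoly-at-1 n st = go (enum𝔇 n)
  where
  go : ∀ ds → sumℤ (λ d → 1ℤ ℤ.^ st (proj₁ d)) ds ≡ ℤ.+ length ds
  go []       = refl
  go (d ∷ ds) = cong₂ ℤ._+_ (ℤ.^-zeroˡ (st (proj₁ d))) (go ds)

lower-or-dual : ∀ s → Lower s ⊎ ∃ λ s' → Dual s s' × Lower s'
lower-or-dual s-nrcpeak     = inj₁ l-nrcpeak
lower-or-dual s-nrcval      = inj₂ (_ , d-nrc , l-nrcpeak)
lower-or-dual s-nrcAll      = inj₁ l-nrcAll
lower-or-dual s-lcrosscpeak = inj₁ l-lcrosscpeak
lower-or-dual s-lnestcpeak  = inj₁ l-lnestcpeak
lower-or-dual s-ucrosscval  = inj₂ (_ , d-crossc , l-lcrosscpeak)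
lower-or-dual s-unestcval   = inj₂ (_ , d-nestc , l-lnestcpeak)
lower-or-dual s-lcross      = inj₁ l-lcross
lower-or-dual s-lnest       = inj₁ l-lnest
lower-or-dual s-ucross      = inj₂ (_ , d-cross , l-lcross)
lower-or-dual s-unest       = inj₂ (_ , d-nest , l-lnest)
lower-or-dual s-cross       = inj₁ l-cross
lower-or-dual s-nest        = inj₁ l-nest

genPoly-at-−1 : ∀ s n → genPoly n (stat s) -1ℤ ≡ ℤ.+ (2 ^ n * F2n-1 n)
genPoly-at-−1 s n with lower-or-dual s
... | inj₁ lower               = genPoly-lower lower n
... | inj₂ (s' , dual , lower) = trans (genPoly-dual dual n -1ℤ) (genPoly-lower lower n)

-- The value at -1 is the same for every statistic, and `fixed` identifies it with the number of
-- fixed points of `φ`.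
theorem6p6 : (s : StatName) → ExhibitsCSP (λ n → 2 ^ n * F2n-1 n) (stat s)
theorem6p6 s n φ _ fixed =
  genPoly-at-1 n (stat s) , trans (genPoly-at-−1 s n) (cong ℤ.+_ (sym fixed))
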